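{- Let $n \ge 3$ and let $M \in \mathcal{T}_n$ be a tournament matrix of order $n$. If $M \in \mathcal{T}_n \setminus \mathcal{S}_n$ (that is, $M$ is nonsingular), then $$C_3(M) \ge n - 2\left\lfloor \frac{n}{3} \right\rfloor.$$ Furthermore, $M \in \mathcal{T}_n \setminus \mathcal{S}_n$ and $C_3(M) = n - 2\left\lfloor \frac{n}{3} \right\rfloor$ if and only if the strongly connected components of $M$ are all upset tournaments and the number of strongly connected components of $M$ is exactly $\left\lfloor \frac{n}{3} \right\rfloor$.
   Context: A tournament of order $n$ is a digraph obtained by orienting each edge of the complete graph on $n$ vertices; a tournament matrix of order $n$ is its adjacency matrix, i.e. an $n \times n$ $(0,1)$-matrix $M$ with $M + M^T = J_n - I_n$, where $J_n$ is the all-ones matrix and $I_n$ the identity ($m_{ij}=1$ iff there is an arc from vertex $i$ to vertex $j$). Tournaments and tournament matrices are identified: graph properties of a tournament are attributed to its matrix and vice versa. $\mathcal{T}_n$ denotes the set of tournament matrices of order $n$, and $\mathcal{S}_n \subseteq \mathcal{T}_n$ the set of singular ones (singularity over the real/complex numbers). $C_3(M)$ is the number of directed $3$-cycles in the tournament $M$, counted as $3$-vertex subsets inducing a directed cycle. The strongly connected components of $M$ are the subtournaments induced on the equivalence classes of vertices under the relation "there is a directed walk from $u$ to $v$ and a directed walk from $v$ to $u$". A transitive tournament is one in which $u \to v$ and $v \to w$ imply $u \to w$. An upset tournament of order $m \ge 3$ is a tournament obtained from a transitive tournament of order $m$ by choosing a directed path from the vertex of outdegree $m-1$ to the vertex of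 outdegree $0$ and reversing all arcs on that path. -}

module Defs where

open import Algebra.Properties.Semiring.Sum as Sum using ()
open import Data.Fin.Base using (Fin; zero; suc; toℕ; fromℕ; inject₁; punchIn)
import Data.Fin.Base as Fin
import Data.Fin.Properties as Fin
open import Data.Fin.Subset using (Subset; inside; outside; ∣_∣; _∈_)
open import Data.Integer.Base using (ℤ; 0ℤ; 1ℤ; -1ℤ; _+_; _-_; _*_; _^_)
import Data.Integer.Properties as ℤ
open import Data.List.Base using (List; length; filter; allFin; cartesianProduct)
open import Data.Nat.Base using (ℕ; zero; suc; _≤_; _∸_)
open import Data.Product.Base using (Σ-syntax; ∃-syntax; _×_; _,_)
open import Data.Sum.Base using (_⊎_)
open import Data.Vec.Base using (Vec; []; _∷_; map; lookup)
open import Function.Bundles using (_⇔_)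
open import Function.Definitions using (Injective)
open import Relation.Binary.Construct.Closure.ReflexiveTransitive using (Star)
open import Relation.Binary.PropositionalEquality.Core using (_≡_)
open import Relation.Nullary.Decidable using (Dec; yes; no; _×-dec_; _⊎-dec_)
open import Relation.Nullary.Negation.Core using (¬_)

open Sum ℤ.+-*-semiring using (sum)

private
  variable
    n : ℕ

Matrix : ℕ → Set
Matrix n = Fin n → Fin n → ℤ

J : Matrix n
J i j = 1ℤ

I : Matrix n
I i j with i Fin.≟ j
... | yes _ = 1ℤ
... | no  _ = 0ℤ

-- Laplace expansion along the first row.
det : Matrix n → ℤ
det {zero}  A = 1ℤ
det {suc n} A = sum λ j → -1ℤ ^ toℕ j * A zero j * det (λ i k → A (suc i) (punchIn j k))

-- The determinant of an integer matrix is the same integer over ℤ, ℚ, ℝ and ℂ,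
-- so this is singularity over the real or complex numbers.
Singular : Matrix n → Set
Singular A = det A ≡ 0ℤ

record IsTournament (M : Matrix n) : Set where
  field
    zero-one : ∀ i j → M i j ≡ 0ℤ ⊎ M i j ≡ 1ℤ
    M+Mᵀ≡J-I : ∀ i j → M i j + M j i ≡ J i j - I i j

Arc : Matrix n → Fin n → Fin n → Set
Arc M u v = M u v ≡ 1ℤ

arc? : (M : Matrix n) (u v : Fin n) → Dec (Arc M u v)
arc? M u v = M u v ℤ.≟ 1ℤ

outdegree : Matrix n → Fin n → ℕ
outdegree {n} M u = length (filter (arc? M u) (allFin n))

-- A 3-element vertex set is represented by its unique listing i < j < k;
-- there are two possible cyclic orientations.
InducesThreeCycle : Matrix n → Fin n × Fin n × Fin n → Set
InducesThreeCycle M (i , j , k) =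
  (i Fin.< j × j Fin.< k) ×
  ((Arc M i j × Arc M j k × Arc M k i) ⊎ (Arc M i k × Arc M k j × Arc M j i))

inducesThreeCycle? : (M : Matrix n) → ∀ t → Dec (InducesThreeCycle M t)
inducesThreeCycle? M (i , j , k) =
  (i Fin.<? j ×-dec j Fin.<? k) ×-dec
  ((arc? M i j ×-dec arc? M j k ×-dec arc? M k i) ⊎-dec
   (arc? M i k ×-dec arc? M k j ×-dec arc? M j i))

C₃ : Matrix n → ℕ
C₃ {n} M = length (filter (inducesThreeCycle? M)
  (cartesianProduct (allFin n) (cartesianProduct (allFin n) (allFin n))))

Walk : Matrix n → Fin n → Fin n → Set
Walk M = Star (Arc M)

_⊢_∼_ : Matrix n → Fin n → Fin n → Set
M ⊢ u ∼ v = Walk M u v × Walk M v u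

IsStrongComponent : Matrix n → Subset n → Set
IsStrongComponent M S = ∃[ u ] (∀ v → v ∈ S ⇔ M ⊢ u ∼ v)

NumberOfStrongComponents : Matrix n → ℕ → Set
NumberOfStrongComponents {n} M k =
  Σ[ f ∈ (Fin k → Subset n) ]
    Injective _≡_ _≡_ f × (∀ S → IsStrongComponent M S ⇔ (∃[ i ] f i ≡ S))

elements : (S : Subset n) → Vec (Fin n) ∣ S ∣
elements []            = []
elements (inside  ∷ S) = zero ∷ map suc (elements S)
elements (outside ∷ S) = map suc (elements S)

-- The vertices of S are relabelled in increasing order.
induced : Matrix n → (S : Subset n) → Matrix ∣ S ∣
induced M S i j = M (lookup (elements S) i) (lookup (elements S) j)

record IsTransitiveTournament (T : Matrix n) : Set where
  field
    isTournament : IsTournament T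
    transitive   : ∀ {u v w} → Arc T u v → Arc T v w → Arc T u w

record Path (T : Matrix n) (s t : Fin n) : Set where
  field
    len      : ℕ
    vertex   : Fin (suc len) → Fin n
    distinct : Injective _≡_ _≡_ vertex
    start    : vertex zero ≡ s
    end      : vertex (fromℕ len) ≡ t
    arcs     : ∀ i → Arc T (vertex (inject₁ i)) (vertex (suc i))

  Uses : Fin n → Fin n → Set
  Uses u v = ∃[ i ] (vertex (inject₁ i) ≡ u × vertex (suc i) ≡ v)

-- M is obtained from T by reversing exactly the arcs of p.
record IsReversal {T : Matrix n} {s t : Fin n} (p : Path T s t) (M : Matrix n) : Set where
  open Path p
  field
    on-path  : ∀ u v → Uses u v ⊎ Uses v u → M u v ≡ T v u
    off-path : ∀ u v → ¬ (Uses u v ⊎ Uses v u) → M u v ≡ T u v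

record IsUpset {m : ℕ} (M : Matrix m) : Set where
  field
    order≥3          : 3 ≤ m
    T                : Matrix m
    T-transitive     : IsTransitiveTournament T
    source sink      : Fin m
    source-outdegree : outdegree T source ≡ m ∸ 1
    sink-outdegree   : outdegree T sink ≡ 0
    path             : Path T source sink
    reversal         : IsReversal path M

{-# OPTIONS --safe #-}
module Submission where

-- A nonzero determinant has a nonzero term in its expansion, that is, a permutation σ all of whose
-- pairs v → σ v are arcs. The σ-orbit of a vertex is a closed walk, so σ preserves every strong
-- component; having no fixed points or 2-cycles, it forces every component to have at least
-- three vertices, and there are k ≤ ⌊n/3⌋ of them. A strong tournament of order m has at least
-- m − 2 three-cycles (enlarge a strong vertex set step by step, each new vertex contributing a new
-- 3-cycle), and every 3-cycle lies in a component; hence C₃ ≥ n − 2k ≥ n − 2⌊n/3⌋.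
--
-- In an upset tournament a 3-cycle is determined by its middle vertex with respect to the
-- transitive order, which is neither the source nor the sink, so C₃ ≤ m − 2. When k = ⌊n/3⌋ the
-- components have 3, 4 or 5 vertices. An enumeration shows that for these orders a tournament without
-- source or sink and with C₃ = m − 2 is one of four upset tournaments, each of which admits exactly
-- one σ as above. These glue to the only σ of M, so a single term of the determinant survives.
-- (The upset tournament of order 6 that reverses a Hamiltonian path is singular,
-- so the restriction on the orders is essential.)

open import Algebra.Properties.Semiring.Sum as Sum using ()
open import Data.Bool.Base using (Bool; true; false; not; if_then_else_)
import Data.Bool.Properties as Bool
open import Data.Fin.Base as Fin using (Fin; zero; suc; toℕ; fromℕ; inject₁; punchIn; punchOut)
open import Data.Fin.Induction using (>-wellFounded)
open import Data.Fin.Patterns using (0F; 1F; 2F; 3F; 4F)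
import Data.Fin.Properties as Fin
open import Data.Fin.Subset using (Subset; inside; outside; ∣_∣) renaming (_∈_ to _∈ˢ_)
open import Data.Fin.Subset.Properties using (⊆-antisym)
open import Data.Integer.Base as ℤ using (ℤ; 0ℤ; 1ℤ; -1ℤ)
import Data.Integer.Properties as ℤ
open import Data.List.Base as List using (List; []; _∷_; length; allFin; filter; concat; cartesianProduct; deduplicate)
open import Data.List.Membership.DecPropositional using () renaming (_∈?_ to mem?)
open import Data.List.Membership.Propositional using (_∈_; _∉_; find; lose)
open import Data.List.Membership.Propositional.Properties
  using (∈-lookup; ∈-allFin; ∈-length; ∈-map⁺; ∈-map⁻; ∈-filter⁺; ∈-filter⁻;
         ∈-tabulate⁺; ∈-tabulate⁻; ∈-concat⁺′; ∈-concat⁻′;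
         ∈-cartesianProduct⁺; ∈-deduplicate⁺; ∈-deduplicate⁻)
open import Data.List.Properties using (length-++; length-map; length-tabulate)
open import Data.List.Relation.Unary.All as All using (All; []; _∷_)
import Data.List.Relation.Unary.All.Properties as All
open import Data.List.Relation.Unary.AllPairs using ([]; _∷_)
import Data.List.Relation.Unary.AllPairs.Properties as AllPairs
open import Data.List.Relation.Unary.Any as Any using (Any; here; there; index)
open import Data.List.Relation.Unary.Any.Properties using (lookup-index)
open import Data.List.Relation.Unary.Unique.DecPropositional.Properties using (deduplicate-!)
open import Data.List.Relation.Unary.Unique.Propositional using (Unique)
import Data.List.Relation.Unary.Unique.Propositional.Properties as Unique
open import Data.Nat.Base as ℕ using (ℕ; zero; suc; _+_; _*_; _∸_; _≤_; _<_; _≥_; z≤n; s≤s; z<s; s<s; s≤s⁻¹)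
open import Data.Nat.DivMod using (_/_; m≡m%n+[m/n]*n; m%n<n; m*n/n≡m; /-monoˡ-≤; m/n*n≤m)
import Data.Nat.Properties as ℕ
open import Data.Product.Base using (Σ-syntax; ∃-syntax; ∃₂; _×_; _,_; proj₁; proj₂; swap)
open import Data.Product.Properties using (,-injectiveˡ; ,-injectiveʳ)
open import Data.Sum.Base using (_⊎_; inj₁; inj₂; [_,_]′)
open import Data.Unit.Base using (⊤; tt)
open import Data.Vec.Base using (Vec; []; _∷_; here; there; lookup; tabulate)
open import Data.Vec.Properties using (lookup-map; lookup∘tabulate; []=⇒lookup; lookup⇒[]=; ≡-dec)
open import Function.Base using (id; _∘_)
open import Function.Bundles using (_⇔_; mk⇔; module Equivalence)
open import Function.Definitions using (Injective)
open import Induction.WellFounded using (Acc; acc)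
open import Relation.Binary.Construct.Closure.ReflexiveTransitive using (ε; _◅_; _◅◅_)
open import Relation.Binary.Definitions using (tri<; tri≈; tri>)
open import Relation.Binary.PropositionalEquality
  using (_≡_; _≢_; refl; sym; trans; cong; cong₂; subst; subst₂; module ≡-Reasoning)
open import Relation.Nullary.Decidable
  using (Dec; yes; no; does; map′; ¬?; _×-dec_; _⊎-dec_; _→-dec_;
         dec-true; decidable-stable; from-yes; True; toWitness)
open import Relation.Nullary.Negation.Core using (¬_; contradiction)
open import Relation.Unary using (Decidable)
open import Defs

open Sum ℕ.+-*-semiring using (sum; sum-cong-≗)
open Sum ℤ.+-*-semiring using () renaming (sum to sumℤ)

private
  variable
    A B : Set
    k m n : ℕ

-- Counting with duplicate-free lists

unique-lookup-injective : {xs : List A} → Unique xs → Injective _≡_ _≡_ (List.lookup xs)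
unique-lookup-injective (_ ∷ _) {zero}  {zero}  _  = refl
unique-lookup-injective {xs = _ ∷ xs} (p ∷ _) {zero}  {suc j} eq = contradiction eq (All.lookup p (∈-lookup j))
unique-lookup-injective (p ∷ _) {suc i} {zero}  eq = contradiction (sym eq) (All.lookup p (∈-lookup i))
unique-lookup-injective (_ ∷ u) {suc i} {suc j} eq = cong suc (unique-lookup-injective u eq)

-- The map may use the membership proof: the middle vertex of a 3-cycle, for instance, is extracted
-- from the proof that the triple is a cycle. Injectivity is therefore asked for arbitrary
-- membership proofs.
injection⇒length-≤ : {xs : List A} {ys : List B} (f : ∀ {x} → x ∈ xs → B) → Unique xs →
  (∀ {x} (p : x ∈ xs) → f p ∈ ys) →
  (∀ {x y} (p : x ∈ xs) (q : y ∈ xs) → f p ≡ f q → x ≡ y) →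
  length xs ≤ length ys
injection⇒length-≤ {xs = xs} {ys} f uniq into inj = Fin.injective⇒≤ {f = g} g-injective
  where
  g : Fin (length xs) → Fin (length ys)
  g i = index (into (∈-lookup i))
  g-injective : Injective _≡_ _≡_ g
  g-injective {i} {j} eq = unique-lookup-injective uniq
    (inj (∈-lookup i) (∈-lookup j)
      (trans (lookup-index (into (∈-lookup i)))
        (trans (cong (List.lookup ys) eq) (sym (lookup-index (into (∈-lookup j)))))))

unique-⊆⇒length-≤ : {xs ys : List A} → Unique xs → (∀ {x} → x ∈ xs → x ∈ ys) → length xs ≤ length ys
unique-⊆⇒length-≤ uniq sub = injection⇒length-≤ (λ {x} _ → x) uniq sub (λ _ _ eq → eq)

unique⇒length-≤ : ∀ {n} {xs : List (Fin n)} → Unique xs → length xs ≤ n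
unique⇒length-≤ {n} {xs} uniq = subst (length xs ≤_) (length-tabulate id) (unique-⊆⇒length-≤ uniq (λ _ → ∈-allFin _))

-- A missed value, put in front of the `n` distinct images, would give `suc n` distinct elements of
-- `Fin n`.
injective⇒surjective : ∀ {n} {f : Fin n → Fin n} → Injective _≡_ _≡_ f → ∀ y → ∃[ x ] f x ≡ y
injective⇒surjective {n} {f} inj y with Fin.any? (λ x → f x Fin.≟ y)
... | yes p = p
... | no ¬p = contradiction
  (subst (λ k → suc k ≤ n) len (unique⇒length-≤ (fresh ∷ Unique.map⁺ inj (Unique.allFin⁺ n)))) ℕ.1+n≰n
  where
  fresh : All (y ≢_) (List.map f (allFin n))
  fresh = All.tabulate λ z∈ y≡z → case (∈-map⁻ f z∈) y≡z
    where
    case : ∀ {z} → ∃[ x ] (x ∈ allFin n × z ≡ f x) → y ≢ z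
    case (x , _ , z≡fx) y≡z = ¬p (x , sym (trans y≡z z≡fx))
  len : length (List.map f (allFin n)) ≡ n
  len = trans (length-map f (allFin n)) (length-tabulate id)

-- Determinants and transversals

-- The index of a nonzero term in the Leibniz expansion: on a finite set an injective self-map is a
-- permutation.
IsTransversal : ∀ {n} → Matrix n → (Fin n → Fin n) → Set
IsTransversal A σ = Injective _≡_ _≡_ σ × (∀ i → A i (σ i) ≢ 0ℤ)

minor : ∀ {n} → Matrix (suc n) → Fin (suc n) → Matrix n
minor A j i k = A (suc i) (punchIn j k)

laplace-term : ∀ {n} → Matrix (suc n) → Fin (suc n) → ℤ
laplace-term A j = -1ℤ ℤ.^ toℕ j ℤ.* A zero j ℤ.* det (minor A j)

*-nonzero : ∀ {a b} → a ≢ 0ℤ → b ≢ 0ℤ → a ℤ.* b ≢ 0ℤ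
*-nonzero {a} a≢0 b≢0 ab≡0 = [ a≢0 , b≢0 ]′ (ℤ.i*j≡0⇒i≡0∨j≡0 a ab≡0)

sign-nonzero : ∀ k → -1ℤ ℤ.^ k ≢ 0ℤ
sign-nonzero zero    = λ ()
sign-nonzero (suc k) = *-nonzero {a = -1ℤ} (λ ()) (sign-nonzero k)

sum-nonzero : ∀ {n} (t : Fin n → ℤ) → sumℤ t ≢ 0ℤ → ∃[ j ] t j ≢ 0ℤ
sum-nonzero {zero}  t s≢0 = contradiction refl s≢0
sum-nonzero {suc n} t s≢0 with t zero ℤ.≟ 0ℤ
... | no  t₀≢0 = zero , t₀≢0
... | yes t₀≡0 with j , tⱼ≢0 ← sum-nonzero (t ∘ suc) (λ r≡0 → s≢0 (cong₂ ℤ._+_ t₀≡0 r≡0)) = suc j , tⱼ≢0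

sum-zero : ∀ {n} (t : Fin n → ℤ) → (∀ j → t j ≡ 0ℤ) → sumℤ t ≡ 0ℤ
sum-zero t t≡0 = decidable-stable (sumℤ t ℤ.≟ 0ℤ) λ s≢0 →
  let j , tⱼ≢0 = sum-nonzero t s≢0 in tⱼ≢0 (t≡0 j)

sum-single : ∀ {n} (t : Fin n → ℤ) j → (∀ k → k ≢ j → t k ≡ 0ℤ) → sumℤ t ≡ t j
sum-single t zero    off = trans
  (cong (λ s → t zero ℤ.+ s) (sum-zero (t ∘ suc) λ k → off (suc k) λ ())) (ℤ.+-identityʳ (t zero))
sum-single t (suc j) off = trans
  (cong₂ ℤ._+_ (off zero λ ()) (sum-single (t ∘ suc) j λ k k≢j → off (suc k) (k≢j ∘ Fin.suc-injective))) (ℤ.+-identityˡ _)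

extend : ∀ {n} → Fin (suc n) → (Fin n → Fin n) → Fin (suc n) → Fin (suc n)
extend j σ zero    = j
extend j σ (suc i) = punchIn j (σ i)

extend-transversal : ∀ {n} (A : Matrix (suc n)) {j σ} → A zero j ≢ 0ℤ →
  IsTransversal (minor A j) σ → IsTransversal A (extend j σ)
extend-transversal A {j} {σ} Aj≢0 (inj , nz) = ext-inj , ext-nz
  where
  ext-inj : Injective _≡_ _≡_ (extend j σ)
  ext-inj {zero}  {zero}  _  = refl
  ext-inj {zero}  {suc k} eq = contradiction (sym eq) (Fin.punchInᵢ≢i j (σ k))
  ext-inj {suc i} {zero}  eq = contradiction eq (Fin.punchInᵢ≢i j (σ i))
  ext-inj {suc i} {suc k} eq = cong suc (inj (Fin.punchIn-injective j (σ i) (σ k) eq))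
  ext-nz : ∀ i → A i (extend j σ i) ≢ 0ℤ
  ext-nz zero    = Aj≢0
  ext-nz (suc i) = nz i

det≢0⇒transversal : ∀ {n} (A : Matrix n) → det A ≢ 0ℤ → ∃[ σ ] IsTransversal A σ
-- A nonzero term has a nonzero entry and a nonzero minor, whose transversal extends by column `j`.
-- The recorded value `σ zero` lets uniqueness of a transversal rule out all columns but one.
term≢0⇒transversal : ∀ {n} (A : Matrix (suc n)) j → laplace-term A j ≢ 0ℤ →
  ∃[ σ ] (IsTransversal A σ × σ zero ≡ j)

det≢0⇒transversal {zero}  A det≢0 = (λ ()) , (λ { {()} }) , λ ()
det≢0⇒transversal {suc n} A det≢0
  with j , t≢0 ← sum-nonzero (laplace-term A) det≢0
  with σ , trans-σ , _ ← term≢0⇒transversal A j t≢0 = σ , trans-σ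

term≢0⇒transversal A j t≢0
  with σ , tr ← det≢0⇒transversal (minor A j) (λ d≡0 →
    t≢0 (trans (cong (-1ℤ ℤ.^ toℕ j ℤ.* A zero j ℤ.*_) d≡0) (ℤ.*-zeroʳ (-1ℤ ℤ.^ toℕ j ℤ.* A zero j))))
  = extend j σ , extend-transversal A Aj≢0 tr , refl
  where
  Aj≢0 : A zero j ≢ 0ℤ
  Aj≢0 a≡0 = t≢0 (cong (ℤ._* det (minor A j)) (trans (cong (-1ℤ ℤ.^ toℕ j ℤ.*_) a≡0) (ℤ.*-zeroʳ (-1ℤ ℤ.^ toℕ j))))

-- A nonzero term in a column other than `h zero` would yield a transversal differing from `h` at
-- `zero`, so one term survives. Its minor inherits uniqueness, because transversals of the minor
-- extend to `A`.
unique-transversal⇒det≢0 : ∀ {n} (A : Matrix n) {h} → IsTransversal A h →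
  (∀ {σ} → IsTransversal A σ → ∀ i → σ i ≡ h i) → det A ≢ 0ℤ
unique-transversal⇒det≢0 {zero}  A trans-h unique ()
unique-transversal⇒det≢0 {suc n} A {h} (h-inj , h-nz) unique det≡0 =
  *-nonzero (*-nonzero (sign-nonzero (toℕ j)) (h-nz zero)) minor≢0 (trans (sym (sum-single (laplace-term A) j off)) det≡0)
  where
  j = h zero

  off : ∀ k → k ≢ j → laplace-term A k ≡ 0ℤ
  off k k≢j = decidable-stable (laplace-term A k ℤ.≟ 0ℤ) λ t≢0 →
    let σ , tr , σ₀≡k = term≢0⇒transversal A k t≢0 in k≢j (trans (sym σ₀≡k) (unique tr zero))

  j≢h : ∀ i → j ≢ h (suc i)
  j≢h i eq with () ← h-inj eq

  h′ : Fin n → Fin n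
  h′ i = punchOut (j≢h i)

  minor≢0 : det (minor A j) ≢ 0ℤ
  minor≢0 = unique-transversal⇒det≢0 (minor A j) {h′}
    ((λ {i} {k} eq → Fin.suc-injective (h-inj (Fin.punchOut-injective (j≢h i) (j≢h k) eq)))
      , λ i → subst (λ z → A (suc i) z ≢ 0ℤ) (sym (Fin.punchIn-punchOut (j≢h i))) (h-nz (suc i)))
    λ {σ} tr i → Fin.punchIn-injective j (σ i) (h′ i)
      (trans (unique (extend-transversal A (h-nz zero) tr) (suc i)) (sym (Fin.punchIn-punchOut (j≢h i))))

-- Tournaments

I-diagonal : (i : Fin n) → I i i ≡ 1ℤ
I-diagonal i with i Fin.≟ i
... | yes _  = refl
... | no i≢i = contradiction refl i≢i

I-off-diagonal : {i j : Fin n} → i ≢ j → I i j ≡ 0ℤ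
I-off-diagonal {i = i} {j} i≢j with i Fin.≟ j
... | yes i≡j = contradiction i≡j i≢j
... | no  _   = refl

module Tournament {M : Matrix n} (isT : IsTournament M) where
  open IsTournament isT

  diagonal : ∀ i → M i i ≡ 0ℤ
  diagonal i with zero-one i i
  ... | inj₁ M≡0 = M≡0
  ... | inj₂ M≡1 with () ← trans (sym (cong₂ ℤ._+_ M≡1 M≡1)) (trans (M+Mᵀ≡J-I i i) (cong (λ x → 1ℤ ℤ.- x) (I-diagonal i)))

  off-diagonal : ∀ {i j} → i ≢ j → M i j ℤ.+ M j i ≡ 1ℤ
  off-diagonal i≢j = trans (M+Mᵀ≡J-I _ _) (cong (λ x → 1ℤ ℤ.- x) (I-off-diagonal i≢j))

  nonzero⇒arc : ∀ {i j} → M i j ≢ 0ℤ → Arc M i j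
  nonzero⇒arc {i} {j} M≢0 with zero-one i j
  ... | inj₁ M≡0 = contradiction M≡0 M≢0
  ... | inj₂ M≡1 = M≡1

  arc⇒nonzero : ∀ {i j} → Arc M i j → M i j ≢ 0ℤ
  arc⇒nonzero M≡1 M≡0 with () ← trans (sym M≡1) M≡0

  arc⇒≢ : ∀ {i j} → Arc M i j → i ≢ j
  arc⇒≢ a refl = arc⇒nonzero a (diagonal _)

  arc-total : ∀ {i j} → i ≢ j → Arc M i j ⊎ Arc M j i
  arc-total {i} {j} i≢j with zero-one i j
  ... | inj₂ M≡1 = inj₁ M≡1
  ... | inj₁ M≡0 = inj₂ (trans (sym (ℤ.+-identityˡ _)) (trans (cong (ℤ._+ M j i) (sym M≡0)) (off-diagonal i≢j)))

  arc⇒reverse-zero : ∀ {i j} → Arc M i j → M j i ≡ 0ℤ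
  arc⇒reverse-zero {i} {j} a with zero-one j i
  ... | inj₁ M≡0 = M≡0
  ... | inj₂ b with () ← trans (sym (cong₂ ℤ._+_ a b)) (off-diagonal (arc⇒≢ a))

  arc-asym : ∀ {i j} → Arc M i j → ¬ Arc M j i
  arc-asym a b = arc⇒nonzero b (arc⇒reverse-zero a)

  arc-flip : ∀ {i j} → i ≢ j → ¬ Arc M i j → Arc M j i
  arc-flip i≢j ¬ij with arc-total i≢j
  ... | inj₁ ij = contradiction ij ¬ij
  ... | inj₂ ji = ji

restrict-tournament : {M : Matrix n} {e : Fin m → Fin n} → Injective _≡_ _≡_ e →
  IsTournament M → IsTournament (λ i j → M (e i) (e j))
restrict-tournament {e = e} e-inj isT = record
  { zero-one = λ i j → zero-one (e i) (e j)
  ; M+Mᵀ≡J-I = λ i j → trans (M+Mᵀ≡J-I (e i) (e j)) (cong (λ x → 1ℤ ℤ.- x) (I-e i j)) }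
  where
  open IsTournament isT
  I-e : ∀ i j → I (e i) (e j) ≡ I i j
  I-e i j with i Fin.≟ j
  ... | yes refl = I-diagonal (e i)
  ... | no  i≢j  = I-off-diagonal (i≢j ∘ e-inj)

-- Orbits of injective maps along arcs

module _ (σ : Fin n → Fin n) where

  iterate : ℕ → Fin n → Fin n
  iterate zero    v = v
  iterate (suc k) v = iterate k (σ v)

  iterate-+ : ∀ i k v → iterate (i ℕ.+ k) v ≡ iterate k (iterate i v)
  iterate-+ zero    k v = refl
  iterate-+ (suc i) k v = iterate-+ i k (σ v)

  iterate-injective : Injective _≡_ _≡_ σ → ∀ k → Injective _≡_ _≡_ (iterate k)
  iterate-injective inj zero    eq = eq
  iterate-injective inj (suc k) eq = inj (iterate-injective inj k eq)

  -- Among the iterates of `v` with exponents `0` to `n` two agree; cancelling the smaller exponent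
  -- by injectivity leaves a period of `v`.
  orbit-returns : Injective _≡_ _≡_ σ → ∀ v → ∃[ k ] iterate k (σ v) ≡ v
  orbit-returns inj v with Fin.pigeonhole ℕ.≤-refl (λ i → iterate (toℕ i) v)
  ... | i , j , i<j , eq = d , sym (iterate-injective inj (toℕ i)
        (trans eq (trans (cong (λ l → iterate l v) j≡) (iterate-+ (suc d) (toℕ i) v))))
    where
    -- One less than the period, since `σ v` already contains the first application.
    d = toℕ j ∸ suc (toℕ i)
    j≡ : toℕ j ≡ suc d ℕ.+ toℕ i
    j≡ = trans (sym (ℕ.m∸n+n≡m i<j)) (ℕ.+-suc d (toℕ i))

  walk-iterate : {M : Matrix n} → (∀ v → Arc M v (σ v)) → ∀ k v → Walk M v (iterate k v)
  walk-iterate arcs zero    v = ε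
  walk-iterate arcs (suc k) v = arcs v ◅ walk-iterate arcs k (σ v)

  walk-back : {M : Matrix n} → Injective _≡_ _≡_ σ → (∀ v → Arc M v (σ v)) → ∀ v → Walk M (σ v) v
  walk-back {M} inj arcs v with orbit-returns inj v
  ... | k , eq = subst (Walk M (σ v)) eq (walk-iterate arcs k (σ v))

-- Strong components

element : (S : Subset n) → Fin ∣ S ∣ → Fin n
element S = lookup (elements S)

element-∈ : (S : Subset n) (a : Fin ∣ S ∣) → element S a ∈ˢ S
element-∈ (inside  ∷ S) zero    = here
element-∈ (inside  ∷ S) (suc a) = subst (_∈ˢ inside ∷ S) (sym (lookup-map a suc (elements S))) (there (element-∈ S a))
element-∈ (outside ∷ S) a       = subst (_∈ˢ outside ∷ S) (sym (lookup-map a suc (elements S))) (there (element-∈ S a))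

position : {S : Subset n} {v : Fin n} → v ∈ˢ S → ∃[ a ] element S a ≡ v
position {S = inside ∷ S} here = zero , refl
position {S = inside ∷ S} (there v∈S) with a , eq ← position v∈S =
  suc a , trans (lookup-map a suc (elements S)) (cong suc eq)
position {S = outside ∷ S} (there v∈S) with a , eq ← position v∈S =
  a , trans (lookup-map a suc (elements S)) (cong suc eq)

element-mono-< : (S : Subset n) {a b : Fin ∣ S ∣} → a Fin.< b → element S a Fin.< element S b
element-mono-< (inside ∷ S) {zero} {suc b} _ =
  subst (λ z → 1 ℕ.≤ toℕ z) (sym (lookup-map b suc (elements S))) (s≤s z≤n)
element-mono-< (inside ∷ S) {suc a} {suc b} (s≤s a<b) =
  subst₂ Fin._<_ (sym (lookup-map a suc (elements S))) (sym (lookup-map b suc (elements S))) (s≤s (element-mono-< S a<b))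
element-mono-< (outside ∷ S) {a} {b} a<b =
  subst₂ Fin._<_ (sym (lookup-map a suc (elements S))) (sym (lookup-map b suc (elements S))) (s≤s (element-mono-< S a<b))

element-injective : (S : Subset n) → Injective _≡_ _≡_ (element S)
element-injective S {a} {b} eq with Fin.<-cmp a b
... | tri< a<b _ _ = contradiction (element-mono-< S a<b) (Fin.<-irrefl eq)
... | tri≈ _ a≡b _ = a≡b
... | tri> _ _ b<a = contradiction (element-mono-< S b<a) (Fin.<-irrefl (sym eq))

element-cancel-< : (S : Subset n) {a b : Fin ∣ S ∣} → element S a Fin.< element S b → a Fin.< b
element-cancel-< S {a} {b} lt with Fin.<-cmp a b
... | tri< a<b _ _  = a<b
... | tri≈ _ refl _ = contradiction lt (Fin.<-irrefl refl)
... | tri> _ _ b<a  = contradiction lt (Fin.<-asym (element-mono-< S b<a))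

does-true : {P : Set} (P? : Dec P) → does P? ≡ true → P
does-true (yes p) _ = p

module _ (M : Matrix n) where

  -- Floyd–Warshall: ws lists the allowed intermediate vertices.
  Reach : List (Fin n) → Fin n → Fin n → Set
  Reach []       u v = u ≡ v ⊎ Arc M u v
  Reach (w ∷ ws) u v = Reach ws u v ⊎ (Reach ws u w × Reach ws w v)

  reach? : ∀ ws u v → Dec (Reach ws u v)
  reach? []       u v = (u Fin.≟ v) ⊎-dec arc? M u v
  reach? (w ∷ ws) u v = reach? ws u v ⊎-dec (reach? ws u w ×-dec reach? ws w v)

  reach⇒walk : ∀ ws {u v} → Reach ws u v → Walk M u v
  reach⇒walk []       (inj₁ refl)    = ε
  reach⇒walk []       (inj₂ a)       = a ◅ ε
  reach⇒walk (w ∷ ws) (inj₁ r)       = reach⇒walk ws r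
  reach⇒walk (w ∷ ws) (inj₂ (r , s)) = reach⇒walk ws r ◅◅ reach⇒walk ws s

  direct⇒reach : ∀ ws {u v} → u ≡ v ⊎ Arc M u v → Reach ws u v
  direct⇒reach []       d = d
  direct⇒reach (w ∷ ws) d = inj₁ (direct⇒reach ws d)

  reach-via : ∀ {ws u x v} → x ∈ ws → Reach ws u x → Reach ws x v → Reach ws u v
  reach-via (here refl) (inj₁ ux)       (inj₁ xv)       = inj₂ (ux , xv)
  reach-via (here refl) (inj₁ ux)       (inj₂ (_ , xv)) = inj₂ (ux , xv)
  reach-via (here refl) (inj₂ (ux , _)) (inj₁ xv)       = inj₂ (ux , xv)
  reach-via (here refl) (inj₂ (ux , _)) (inj₂ (_ , xv)) = inj₂ (ux , xv)
  reach-via (there x∈) (inj₁ ux)        (inj₁ xv)        = inj₁ (reach-via x∈ ux xv)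
  reach-via (there x∈) (inj₁ ux)        (inj₂ (xw , wv)) = inj₂ (reach-via x∈ ux xw , wv)
  reach-via (there x∈) (inj₂ (uw , wx)) (inj₁ xv)        = inj₂ (uw , reach-via x∈ wx xv)
  reach-via (there x∈) (inj₂ (uw , _))  (inj₂ (_ , wv))  = inj₂ (uw , wv)

  walk⇒reach : ∀ {u v} → Walk M u v → Reach (allFin n) u v
  walk⇒reach ε       = direct⇒reach (allFin n) (inj₁ refl)
  walk⇒reach (a ◅ w) = reach-via (∈-allFin _) (direct⇒reach (allFin n) (inj₂ a)) (walk⇒reach w)

  walk? : ∀ u v → Dec (Walk M u v)
  walk? u v = map′ (reach⇒walk (allFin n)) walk⇒reach (reach? (allFin n) u v)

  _∼?_ : ∀ u v → Dec (M ⊢ u ∼ v)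
  u ∼? v = walk? u v ×-dec walk? v u

  ∼-sym : ∀ {u v} → M ⊢ u ∼ v → M ⊢ v ∼ u
  ∼-sym = swap

  ∼-trans : ∀ {u v w} → M ⊢ u ∼ v → M ⊢ v ∼ w → M ⊢ u ∼ w
  ∼-trans (uv , vu) (vw , wv) = uv ◅◅ vw , wv ◅◅ vu

  component : Fin n → Subset n
  component u = tabulate λ v → does (u ∼? v)

  ∈-component⁺ : ∀ {u v} → M ⊢ u ∼ v → v ∈ˢ component u
  ∈-component⁺ {u} {v} u∼v = lookup⇒[]= v (component u) (trans (lookup∘tabulate _ v) (dec-true (u ∼? v) u∼v))

  ∈-component⁻ : ∀ {u v} → v ∈ˢ component u → M ⊢ u ∼ v
  ∈-component⁻ {u} {v} v∈ = does-true (u ∼? v) (trans (sym (lookup∘tabulate _ v)) ([]=⇒lookup v∈))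

  component-isStrong : ∀ u → IsStrongComponent M (component u)
  component-isStrong u = u , λ v → mk⇔ ∈-component⁻ ∈-component⁺

  isStrong⇒component : ∀ {S} → IsStrongComponent M S → ∃[ u ] S ≡ component u
  isStrong⇒component (u , S⇔) = u , ⊆-antisym
    (λ {v} v∈S → ∈-component⁺ (Equivalence.to (S⇔ v) v∈S))
    (λ {v} v∈ → Equivalence.from (S⇔ v) (∈-component⁻ v∈))

  component-cong : ∀ {u v} → M ⊢ u ∼ v → component u ≡ component v
  component-cong u∼v = ⊆-antisym
    (λ w∈ → ∈-component⁺ (∼-trans (∼-sym u∼v) (∈-component⁻ w∈)))
    (λ w∈ → ∈-component⁺ (∼-trans u∼v (∈-component⁻ w∈)))

  componentList : List (Subset n)
  componentList = deduplicate (≡-dec Bool._≟_) (List.map component (allFin n))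

  numberOfStrongComponents : NumberOfStrongComponents M (length componentList)
  numberOfStrongComponents = List.lookup componentList
    , unique-lookup-injective (deduplicate-! (≡-dec Bool._≟_) (List.map component (allFin n)))
    , λ S → mk⇔ listed isComponent
    where
    listed : ∀ {S} → IsStrongComponent M S → ∃[ i ] List.lookup componentList i ≡ S
    listed strong with u , refl ← isStrong⇒component strong =
      let u∈ = ∈-deduplicate⁺ (≡-dec Bool._≟_) (∈-map⁺ component (∈-allFin u)) in index u∈ , sym (lookup-index u∈)
    isComponent : ∀ {S} → ∃[ i ] List.lookup componentList i ≡ S → IsStrongComponent M S
    isComponent (i , refl)
      with u , _ , eq ← ∈-map⁻ component (∈-deduplicate⁻ (≡-dec Bool._≟_) (List.map component (allFin n)) (∈-lookup i))
      = subst (IsStrongComponent M) (sym eq) (component-isStrong u)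

-- An indexed form of the strong components suited to summation over `Fin k`. Both the computed list
-- of components and a family given by hypothesis are brought into it.
record Partition (M : Matrix n) (k : ℕ) : Set where
  field
    part     : Fin k → Subset n
    isStrong : ∀ i → IsStrongComponent M (part i)
    covers   : ∀ v → ∃[ i ] v ∈ˢ part i
    disjoint : ∀ {v i j} → v ∈ˢ part i → v ∈ˢ part j → i ≡ j

  linked : ∀ {i u v} → u ∈ˢ part i → v ∈ˢ part i → M ⊢ u ∼ v
  linked {i} {u} {v} u∈ v∈ with r , iff ← isStrong i =
    ∼-trans M (∼-sym M (Equivalence.to (iff u) u∈)) (Equivalence.to (iff v) v∈)

  closed : ∀ {i u v} → u ∈ˢ part i → M ⊢ u ∼ v → v ∈ˢ part i
  closed {i} {u} {v} u∈ u∼v with r , iff ← isStrong i =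
    Equivalence.from (iff v) (∼-trans M (Equivalence.to (iff u) u∈) u∼v)

partition : {M : Matrix n} → NumberOfStrongComponents M k → Partition M k
partition {M = M} (f , f-inj , f⇔) = record
  { part     = f
  ; isStrong = strong
  ; covers   = λ v → let i , eq = Equivalence.to (f⇔ (component M v)) (component-isStrong M v)
                     in i , subst (v ∈ˢ_) (sym eq) (∈-component⁺ M (ε , ε))
  -- Two parts through `v` are both the component of `v`, so injectivity of the listing identifies
  -- their indices.
  ; disjoint = λ {v} {i} {j} v∈i v∈j → f-inj (trans (≡component v∈i) (sym (≡component v∈j)))
  }
  where
  strong : ∀ i → IsStrongComponent M (f i)
  strong i = Equivalence.from (f⇔ (f i)) (i , refl)
  ≡component : ∀ {v i} → v ∈ˢ f i → f i ≡ component M v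
  ≡component {v} {i} v∈ with u , eq ← isStrong⇒component M (strong i) =
    trans eq (component-cong M (∈-component⁻ M (subst (v ∈ˢ_) eq v∈)))

-- 3-cycles, component by component

length-concat-tabulate : {B : Set} (g : Fin k → List B) → length (concat (List.tabulate g)) ≡ sum (length ∘ g)
length-concat-tabulate {zero}  g = refl
length-concat-tabulate {suc k} g = trans (length-++ (g zero)) (cong (length (g zero) +_) (length-concat-tabulate (g ∘ suc)))

sum-lengths : {B : Set} (g : Fin k → List B) (ys : List B) →
  (∀ i → Unique (g i)) → (∀ {x i j} → x ∈ g i → x ∈ g j → i ≡ j) → Unique ys →
  (∀ {x i} → x ∈ g i → x ∈ ys) → (∀ {x} → x ∈ ys → ∃[ i ] x ∈ g i) →
  sum (length ∘ g) ≡ length ys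
sum-lengths g ys g-unique disj ys-unique into onto =
  trans (sym (length-concat-tabulate g)) (ℕ.≤-antisym
    (unique-⊆⇒length-≤ concat-unique concat⊆ys)
    (unique-⊆⇒length-≤ ys-unique λ x∈ → let i , x∈i = onto x∈ in ∈-concat⁺′ x∈i (∈-tabulate⁺ i)))
  where
  concat-unique : Unique (concat (List.tabulate g))
  concat-unique = Unique.concat⁺ (All.tabulate⁺ g-unique)
    (AllPairs.tabulate⁺ λ i≢j (x∈i , x∈j) → i≢j (disj x∈i x∈j))
  concat⊆ys : ∀ {x} → x ∈ concat (List.tabulate g) → x ∈ ys
  concat⊆ys x∈ with _ , x∈xs , xs∈ ← ∈-concat⁻′ (List.tabulate g) x∈ with i , refl ← ∈-tabulate⁻ xs∈ = into x∈xs

Triple : ℕ → Set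
Triple n = Fin n × Fin n × Fin n

threeCycles : Matrix n → List (Triple n)
threeCycles {n} M = filter (inducesThreeCycle? M) (cartesianProduct (allFin n) (cartesianProduct (allFin n) (allFin n)))

threeCycles-unique : (M : Matrix n) → Unique (threeCycles M)
threeCycles-unique {n} M = Unique.filter⁺ (inducesThreeCycle? M)
  (Unique.cartesianProduct⁺ (Unique.allFin⁺ n) (Unique.cartesianProduct⁺ (Unique.allFin⁺ n) (Unique.allFin⁺ n)))

∈-threeCycles⁺ : (M : Matrix n) {t : Triple n} → InducesThreeCycle M t → t ∈ threeCycles M
∈-threeCycles⁺ M cyc = ∈-filter⁺ (inducesThreeCycle? M)
  (∈-cartesianProduct⁺ (∈-allFin _) (∈-cartesianProduct⁺ (∈-allFin _) (∈-allFin _))) cyc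

∈-threeCycles⁻ : (M : Matrix n) {t : Triple n} → t ∈ threeCycles M → InducesThreeCycle M t
∈-threeCycles⁻ {n} M t∈ = proj₂ (∈-filter⁻ (inducesThreeCycle? M)
  {xs = cartesianProduct (allFin n) (cartesianProduct (allFin n) (allFin n))} t∈)

embed : (S : Subset n) → Triple ∣ S ∣ → Triple n
embed S (a , b , c) = element S a , element S b , element S c

embed-injective : (S : Subset n) {s t : Triple ∣ S ∣} → embed S s ≡ embed S t → s ≡ t
embed-injective S eq = cong₂ _,_ (element-injective S (,-injectiveˡ eq))
  (cong₂ _,_ (element-injective S (,-injectiveˡ (,-injectiveʳ eq))) (element-injective S (,-injectiveʳ (,-injectiveʳ eq))))

embed-cycle⁺ : (M : Matrix n) (S : Subset n) {t : Triple ∣ S ∣} →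
  InducesThreeCycle (induced M S) t → InducesThreeCycle M (embed S t)
embed-cycle⁺ M S ((a<b , b<c) , arcs) = (element-mono-< S a<b , element-mono-< S b<c) , arcs

embed-cycle⁻ : (M : Matrix n) (S : Subset n) {t : Triple ∣ S ∣} →
  InducesThreeCycle M (embed S t) → InducesThreeCycle (induced M S) t
embed-cycle⁻ M S ((a<b , b<c) , arcs) = (element-cancel-< S a<b , element-cancel-< S b<c) , arcs

cycle-∼ : (M : Matrix n) {i j k : Fin n} → InducesThreeCycle M (i , j , k) → M ⊢ i ∼ j × M ⊢ i ∼ k
cycle-∼ M (_ , inj₁ (ij , jk , ki)) = (ij ◅ ε , jk ◅ ki ◅ ε) , (ij ◅ jk ◅ ε , ki ◅ ε)
cycle-∼ M (_ , inj₂ (ik , kj , ji)) = (ik ◅ kj ◅ ε , ji ◅ ε) , (ik ◅ ε , kj ◅ ji ◅ ε)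

module _ {M : Matrix n} (P : Partition M k) where
  open Partition P

  sum-sizes : sum (λ i → ∣ part i ∣) ≡ n
  sum-sizes = trans (sum-cong-≗ λ i → sym (trans (length-map (element (part i)) (allFin ∣ part i ∣)) (length-tabulate id)))
    (trans (sum-lengths (λ i → List.map (element (part i)) (allFin ∣ part i ∣)) (allFin n)
      (λ i → Unique.map⁺ (element-injective (part i)) (Unique.allFin⁺ _))
      (λ x∈i x∈j → disjoint (in-part x∈i) (in-part x∈j))
      (Unique.allFin⁺ n)
      (λ _ → ∈-allFin _)
      λ {x} _ → let i , x∈i = covers x ; a , eq = position x∈i in
        i , subst (_∈ List.map (element (part i)) (allFin ∣ part i ∣)) eq (∈-map⁺ (element (part i)) (∈-allFin a)))
    (length-tabulate id))
    where
    in-part : ∀ {x i} → x ∈ List.map (element (part i)) (allFin ∣ part i ∣) → x ∈ˢ part i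
    in-part {i = i} x∈ with a , _ , refl ← ∈-map⁻ (element (part i)) x∈ = element-∈ (part i) a

  -- The vertices of a 3-cycle reach one another, so they lie in one part; relabelling by the
  -- increasing map `element` keeps their listing in order.
  sum-C₃ : sum (λ i → C₃ (induced M (part i))) ≡ C₃ M
  sum-C₃ = trans (sum-cong-≗ λ i → sym (length-map (embed (part i)) (threeCycles (induced M (part i)))))
    (sum-lengths cycles (threeCycles M)
      (λ i → Unique.map⁺ (embed-injective (part i)) (threeCycles-unique (induced M (part i))))
      (λ x∈i x∈j → disjoint (in-part x∈i) (in-part x∈j))
      (threeCycles-unique M) into onto)
    where
    cycles : Fin k → List (Triple n)
    cycles i = List.map (embed (part i)) (threeCycles (induced M (part i)))

    in-part : ∀ {t i} → t ∈ cycles i → proj₁ t ∈ˢ part i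
    in-part {i = i} t∈ with s , _ , refl ← ∈-map⁻ (embed (part i)) t∈ = element-∈ (part i) (proj₁ s)

    into : ∀ {t i} → t ∈ cycles i → t ∈ threeCycles M
    into {i = i} t∈ with s , s∈ , refl ← ∈-map⁻ (embed (part i)) t∈ =
      ∈-threeCycles⁺ M (embed-cycle⁺ M (part i) (∈-threeCycles⁻ (induced M (part i)) s∈))

    onto : ∀ {t} → t ∈ threeCycles M → ∃[ i ] t ∈ cycles i
    onto {u , v , w} t∈
      with cyc ← ∈-threeCycles⁻ M t∈
      with u∼v , u∼w ← cycle-∼ M cyc
      with i , u∈ ← covers u
      with a , refl ← position u∈ | b , refl ← position (closed u∈ u∼v) | c , refl ← position (closed u∈ u∼w)
      = i , ∈-map⁺ (embed (part i)) (∈-threeCycles⁺ (induced M (part i)) (embed-cycle⁻ M (part i) cyc))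

-- Strong tournaments have many 3-cycles

Member : Fin n → Triple n → Set
Member x (i , j , k) = x ≡ i ⊎ x ≡ j ⊎ x ≡ k

-- Strong connectivity in the form: every proper nonempty vertex set has an arc leaving it.
IsStrong : Matrix m → Set₁
IsStrong {m} A = ∀ {X : Fin m → Set} → Decidable X → ∀ {x y} → X x → ¬ X y →
  ∃₂ λ u v → X u × ¬ X v × Arc A u v

Crossing : Matrix m → (Fin m → Set) → List (Fin m) → Set
Crossing A X S = ∃₂ λ u v → X u × ¬ X v × Arc A u v × u ∈ S × v ∈ S

StrongOn : Matrix m → List (Fin m) → Set₁
StrongOn {m} A S = ∀ {X : Fin m → Set} → Decidable X → ∀ {x y} → x ∈ S → y ∈ S → X x → ¬ X y →
  Crossing A X S

crossing-mono : {A : Matrix m} {X : Fin m → Set} {S S′ : List (Fin m)} →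
  (∀ {x} → x ∈ S → x ∈ S′) → Crossing A X S → Crossing A X S′
crossing-mono S⊆S′ (u , v , Xu , ¬Xv , uv , u∈ , v∈) = u , v , Xu , ¬Xv , uv , S⊆S′ u∈ , S⊆S′ v∈

<-connex : {a b : Fin n} → a ≢ b → a Fin.< b ⊎ b Fin.< a
<-connex {a = a} {b} a≢b with Fin.<-cmp a b
... | tri< a<b _ _ = inj₁ a<b
... | tri≈ _ a≡b _ = contradiction a≡b a≢b
... | tri> _ _ b<a = inj₂ b<a

-- For R = _<_ this is InducesThreeCycle.
CyclicTriple : (Fin m → Fin m → Set) → Matrix m → Triple m → Set
CyclicTriple R A (i , j , k) =
  (R i j × R j k) ×
  ((Arc A i j × Arc A j k × Arc A k i) ⊎ (Arc A i k × Arc A k j × Arc A j i))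

module _ {A : Matrix m} (isT : IsTournament A) where
  open Tournament isT

  -- Only the two consecutive comparisons of the listing are required, so `R` may be any total
  -- comparison of distinct vertices. It is used with the order of the labels and with the arcs of
  -- the transitive tournament behind an upset.
  sort-cycle : ∀ {R : Fin m → Fin m → Set} → (∀ {a b} → a ≢ b → R a b ⊎ R b a) →
    ∀ {a b c} → Arc A a b → Arc A b c → Arc A c a →
    ∃[ t ] (CyclicTriple R A t × (Member a t × Member b t × Member c t) × (∀ {x} → Member x t → x ≡ a ⊎ x ≡ b ⊎ x ≡ c))
  sort-cycle connex {a} {b} {c} ab bc ca with connex (arc⇒≢ ab) | connex (arc⇒≢ bc) | connex (arc⇒≢ ca)
  ... | inj₁ a<b | inj₁ b<c | _ = (a , b , c) , ((a<b , b<c) , inj₁ (ab , bc , ca))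
        , (inj₁ refl , inj₂ (inj₁ refl) , inj₂ (inj₂ refl)) , id
  ... | inj₁ a<b | inj₂ c<b | inj₁ c<a = (c , a , b) , ((c<a , a<b) , inj₁ (ca , ab , bc))
        , (inj₂ (inj₁ refl) , inj₂ (inj₂ refl) , inj₁ refl)
        , λ { (inj₁ e) → inj₂ (inj₂ e) ; (inj₂ (inj₁ e)) → inj₁ e ; (inj₂ (inj₂ e)) → inj₂ (inj₁ e) }
  ... | inj₁ a<b | inj₂ c<b | inj₂ a<c = (a , c , b) , ((a<c , c<b) , inj₂ (ab , bc , ca))
        , (inj₁ refl , inj₂ (inj₂ refl) , inj₂ (inj₁ refl))
        , λ { (inj₁ e) → inj₁ e ; (inj₂ (inj₁ e)) → inj₂ (inj₂ e) ; (inj₂ (inj₂ e)) → inj₂ (inj₁ e) }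
  ... | inj₂ b<a | inj₁ b<c | inj₁ c<a = (b , c , a) , ((b<c , c<a) , inj₁ (bc , ca , ab))
        , (inj₂ (inj₂ refl) , inj₁ refl , inj₂ (inj₁ refl))
        , λ { (inj₁ e) → inj₂ (inj₁ e) ; (inj₂ (inj₁ e)) → inj₂ (inj₂ e) ; (inj₂ (inj₂ e)) → inj₁ e }
  ... | inj₂ b<a | inj₁ b<c | inj₂ a<c = (b , a , c) , ((b<a , a<c) , inj₂ (bc , ca , ab))
        , (inj₂ (inj₁ refl) , inj₁ refl , inj₂ (inj₂ refl))
        , λ { (inj₁ e) → inj₂ (inj₁ e) ; (inj₂ (inj₁ e)) → inj₁ e ; (inj₂ (inj₂ e)) → inj₂ (inj₂ e) }
  ... | inj₂ b<a | inj₂ c<b | _ = (c , b , a) , ((c<b , b<a) , inj₂ (ca , ab , bc))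
        , (inj₂ (inj₂ refl) , inj₂ (inj₁ refl) , inj₁ refl)
        , λ { (inj₁ e) → inj₂ (inj₂ e) ; (inj₂ (inj₁ e)) → inj₂ (inj₁ e) ; (inj₂ (inj₂ e)) → inj₁ e }

  -- The invariant of the growth. `within` makes a cycle through a new vertex automatically new, and
  -- the additive `bound` lets the growth start from one vertex without cycles.
  record Grown (S : List (Fin m)) (ts : List (Triple m)) : Set₁ where
    field
      S-unique  : Unique S
      strong    : StrongOn A S
      ts-unique : Unique ts
      cycles    : ∀ {t} → t ∈ ts → InducesThreeCycle A t
      within    : ∀ {t x} → t ∈ ts → Member x t → x ∈ S
      bound     : length S ≤ 2 + length ts

  fresh : ∀ {S : List (Fin m)} {v} → v ∉ S → All (v ≢_) S
  fresh v∉S = All.tabulate λ x∈ v≡x → v∉S (subst (_∈ _) (sym v≡x) x∈)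

  -- In a separated pair `v` can be replaced by `a` if it comes first and by `b` if it comes second,
  -- unless the arc `v → a` or `b → v` itself crosses.
  strongOn-mixed : ∀ {S v a b} → StrongOn A S → a ∈ S → b ∈ S → Arc A v a → Arc A b v → StrongOn A (v ∷ S)
  strongOn-mixed {S} {v} {a} {b} str a∈ b∈ va bv {X} X? = go
    where
    inner : ∀ {x y} → x ∈ S → y ∈ S → X x → ¬ X y → Crossing A X (v ∷ S)
    inner x∈ y∈ Xx ¬Xy = crossing-mono {A = A} there (str X? x∈ y∈ Xx ¬Xy)
    go : ∀ {x y} → x ∈ v ∷ S → y ∈ v ∷ S → X x → ¬ X y → Crossing A X (v ∷ S)
    go (there x∈) (there y∈) Xx ¬Xy = inner x∈ y∈ Xx ¬Xy
    go (here refl) (here refl) Xx ¬Xy = contradiction Xx ¬Xy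
    go (here refl) (there y∈) Xv ¬Xy with X? a
    ... | yes Xa = inner a∈ y∈ Xa ¬Xy
    ... | no ¬Xa = v , a , Xv , ¬Xa , va , here refl , there a∈
    go (there x∈) (here refl) Xx ¬Xv with X? b
    ... | yes Xb = b , v , Xb , ¬Xv , bv , there b∈ , here refl
    ... | no ¬Xb = inner x∈ b∈ Xx ¬Xb

  -- A cut that splits the cycle `s → b → a → s` is crossed by one of its arcs. Otherwise it
  -- separates `s` from another vertex of `S`, and `str` applies.
  strongOn-pair : ∀ {S s a b} → StrongOn A S → s ∈ S → Arc A s b → Arc A b a → Arc A a s → StrongOn A (b ∷ a ∷ S)
  strongOn-pair {S} {s} {a} {b} str s∈ sb ba as {X} X? {x} {y} x∈ y∈ Xx ¬Xy with X? s | X? b | X? a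
  ... | yes Xs | no ¬Xb | _      = s , b , Xs , ¬Xb , sb , there (there s∈) , here refl
  ... | _      | yes Xb | no ¬Xa = b , a , Xb , ¬Xa , ba , here refl , there (here refl)
  ... | no ¬Xs | _      | yes Xa = a , s , Xa , ¬Xs , as , there (here refl) , there (there s∈)
  ... | yes Xs | yes Xb | yes Xa = crossing-mono {A = A} (λ z∈ → there (there z∈)) (str X? s∈ (outer y∈) Xs ¬Xy)
    where
    outer : y ∈ b ∷ a ∷ S → y ∈ S
    outer (here refl)         = contradiction Xb ¬Xy
    outer (there (here refl)) = contradiction Xa ¬Xy
    outer (there (there y∈))  = y∈
  ... | no ¬Xs | no ¬Xb | no ¬Xa = crossing-mono {A = A} (λ z∈ → there (there z∈)) (str X? (outer x∈) s∈ Xx ¬Xs)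
    where
    outer : x ∈ b ∷ a ∷ S → x ∈ S
    outer (here refl)         = contradiction Xx ¬Xb
    outer (there (here refl)) = contradiction Xx ¬Xa
    outer (there (there x∈))  = x∈

  grow-mixed : ∀ {S ts v x y} → Grown S ts → v ∉ S → x ∈ S → Arc A v x → y ∈ S → Arc A y v → ∃[ t ] Grown (v ∷ S) (t ∷ ts)
  grow-mixed {S} {ts} {v} {x} {y} G v∉S x∈ vx y∈ yv
    -- Cut `S` along the out-neighbours of `v`: the crossing arc `a → b` has `v → a` and, as `b` is
    -- not an out-neighbour, `b → v`.
    with a , b , va , ¬vb , ab , a∈ , b∈ ← Grown.strong G (arc? A v) x∈ y∈ vx (arc-asym yv)
    with bv ← arc-flip (λ { refl → v∉S b∈ }) ¬vb
    with t , cyc , (v∈t , _) , t⊆ ← sort-cycle {R = Fin._<_} <-connex va ab bv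
    = t , record
      { S-unique  = fresh v∉S ∷ Grown.S-unique G
      ; strong    = strongOn-mixed (Grown.strong G) a∈ b∈ va bv
      ; ts-unique = All.tabulate (λ { t∈ refl → v∉S (Grown.within G t∈ v∈t) }) ∷ Grown.ts-unique G
      ; cycles    = λ { (here refl) → cyc ; (there t∈) → Grown.cycles G t∈ }
      ; within    = λ { (here refl) z∈ → in-S (t⊆ z∈) a∈ b∈ ; (there t∈) z∈ → there (Grown.within G t∈ z∈) }
      ; bound     = s≤s (Grown.bound G)
      }
    where
    in-S : ∀ {z a b} → z ≡ v ⊎ z ≡ a ⊎ z ≡ b → a ∈ S → b ∈ S → z ∈ v ∷ S
    in-S (inj₁ refl)        _  _  = here refl
    in-S (inj₂ (inj₁ refl)) a∈ _  = there a∈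
    in-S (inj₂ (inj₂ refl)) _  b∈ = there b∈

  -- Each old vertex `x` lies on a new cycle `x → b → a → x`, and two of these pay for the two added
  -- vertices.
  grow-pair : ∀ {s S ts a b} → Grown (s ∷ S) ts → a ∉ s ∷ S → b ∉ s ∷ S →
    (∀ {x} → x ∈ s ∷ S → Arc A x b) → Arc A b a → (∀ {x} → x ∈ s ∷ S → Arc A a x) →
    ∃[ ts′ ] Grown (b ∷ a ∷ s ∷ S) ts′
  grow-pair {s} {S} {ts} {a} {b} G a∉ b∉ xb ba ax
    with t , cyc , (s∈t , b∈t , _) , t⊆ ← sort-cycle {R = Fin._<_} <-connex (xb (here refl)) ba (ax (here refl))
    = attach S G a∉ b∉ xb ax t⊆
    where
    open Grown
    in-S : ∀ {z x S} → x ∈ S → z ≡ x ⊎ z ≡ b ⊎ z ≡ a → z ∈ b ∷ a ∷ S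
    in-S x∈ (inj₁ refl)        = there (there x∈)
    in-S x∈ (inj₂ (inj₁ refl)) = here refl
    in-S x∈ (inj₂ (inj₂ refl)) = there (here refl)
    grown-unique : ∀ {S} → Unique S → a ∉ S → b ∉ S → Unique (b ∷ a ∷ S)
    grown-unique u a∉ b∉ = (arc⇒≢ ba ∷ fresh b∉) ∷ fresh a∉ ∷ u
    attach : ∀ S → Grown (s ∷ S) ts → a ∉ s ∷ S → b ∉ s ∷ S →
      (∀ {x} → x ∈ s ∷ S → Arc A x b) → (∀ {x} → x ∈ s ∷ S → Arc A a x) →
      (∀ {x} → Member x t → x ≡ s ⊎ x ≡ b ⊎ x ≡ a) → ∃[ ts′ ] Grown (b ∷ a ∷ s ∷ S) ts′
    -- With one old vertex there is a single such cycle, which is enough for three vertices.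
    attach [] G a∉ b∉ xb ax t⊆ = t ∷ ts , record
      { S-unique  = grown-unique (S-unique G) a∉ b∉
      ; strong    = strongOn-pair (strong G) (here refl) (xb (here refl)) ba (ax (here refl))
      ; ts-unique = All.tabulate (λ { t∈ refl → b∉ (within G t∈ b∈t) }) ∷ ts-unique G
      ; cycles    = λ { (here refl) → cyc ; (there t∈) → cycles G t∈ }
      ; within    = λ { (here refl) z∈ → in-S (here refl) (t⊆ z∈) ; (there t∈) z∈ → there (there (within G t∈ z∈)) }
      ; bound     = s≤s (s≤s (s≤s z≤n))
      }
    -- A second old vertex gives a second cycle, different from the first because it misses `s`.
    attach (s′ ∷ S) G a∉ b∉ xb ax t⊆
      with t′ , cyc′ , (_ , b∈t′ , _) , t′⊆ ← sort-cycle {R = Fin._<_} <-connex (xb (there (here refl))) ba (ax (there (here refl)))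
      = t ∷ t′ ∷ ts , record
      { S-unique  = grown-unique (S-unique G) a∉ b∉
      ; strong    = strongOn-pair (strong G) (here refl) (xb (here refl)) ba (ax (here refl))
      ; ts-unique = ((λ { refl → s∉t′ (S-unique G) (t′⊆ s∈t) }) ∷ All.tabulate (λ { t∈ refl → b∉ (within G t∈ b∈t) }))
                    ∷ All.tabulate (λ { t∈ refl → b∉ (within G t∈ b∈t′) }) ∷ ts-unique G
      ; cycles    = λ { (here refl) → cyc ; (there (here refl)) → cyc′ ; (there (there t∈)) → cycles G t∈ }
      ; within    = λ { (here refl) z∈ → in-S (here refl) (t⊆ z∈)
                      ; (there (here refl)) z∈ → in-S (there (here refl)) (t′⊆ z∈)
                      ; (there (there t∈)) z∈ → there (there (within G t∈ z∈)) }
      ; bound     = s≤s (s≤s (bound G))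
      }
      where
      s∉t′ : Unique (s ∷ s′ ∷ S) → ¬ (s ≡ s′ ⊎ s ≡ b ⊎ s ≡ a)
      s∉t′ ((s≢s′ ∷ _) ∷ _) (inj₁ s≡s′)     = s≢s′ s≡s′
      s∉t′ _                (inj₂ (inj₁ refl)) = b∉ (here refl)
      s∉t′ _                (inj₂ (inj₂ refl)) = a∉ (here refl)

  module _ (A-strong : IsStrong A) where

    module _ (S : List (Fin m)) where
      _∈?S : ∀ v → Dec (v ∈ S)
      v ∈?S = mem? Fin._≟_ v S

      HasOut HasIn : Fin m → Set
      HasOut v = Any (Arc A v) S
      HasIn  v = Any (λ x → Arc A x v) S

      hasOut? : Decidable HasOut
      hasOut? v = Any.any? (arc? A v) S

      hasIn? : Decidable HasIn
      hasIn? v = Any.any? (λ x → arc? A x v) S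

      -- If no vertex outside S is mixed, the outside splits into vertices dominated by S and
      -- vertices dominating S, and strong connectivity yields an arc from the former to the latter.
      dominated-dominating : ∀ {s v} → s ∈ S → v ∉ S → (∀ v → v ∉ S → ¬ (HasOut v × HasIn v)) →
        ∃₂ λ b a → b ∉ S × a ∉ S × ¬ HasOut b × HasOut a × Arc A b a
      dominated-dominating {s} {v} s∈ v∉ unmixed with hasOut? v
      -- Cut off the dominating vertices: an arc entering them at `w` cannot start in `S`, or `w`
      -- would be mixed.
      ... | yes out
        with u , w , ¬dom-u , ¬¬dom-w , uw ← A-strong
          (λ x → ¬? (¬? (x ∈?S) ×-dec hasOut? x)) {s} {v} (λ (s∉ , _) → s∉ s∈) (λ ¬dom → ¬dom (v∉ , out))
        with w∉ , w-out ← decidable-stable (¬? (w ∈?S) ×-dec hasOut? w) ¬¬dom-w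
        = u , w , u∉ w∉ w-out uw , w∉ , (λ u-out → ¬dom-u (u∉ w∉ w-out uw , u-out)) , w-out , uw
        where
        u∉ : ∀ {u w} → w ∉ S → HasOut w → Arc A u w → u ∉ S
        u∉ {w = w} w∉ w-out uw u∈ = unmixed w w∉ (w-out , lose u∈ uw)
      -- Cut off the dominated vertices: an arc leaving them cannot end in `S`.
      ... | no ¬out
        with u , w , (u∉ , ¬u-out) , ¬dom-w , uw ← A-strong
          (λ x → ¬? (x ∈?S) ×-dec ¬? (hasOut? x)) {v} {s} (v∉ , ¬out) (λ (s∉ , _) → s∉ s∈)
        = u , w , u∉ , w∉ ¬u-out uw , ¬u-out
        , decidable-stable (hasOut? w) (λ ¬w-out → ¬dom-w (w∉ ¬u-out uw , ¬w-out)) , uw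
        where
        w∉ : ∀ {u w} → ¬ HasOut u → Arc A u w → w ∉ S
        w∉ ¬u-out uw w∈ = ¬u-out (lose w∈ uw)

    -- Either a mixed vertex is added alone, or a dominated and a dominating vertex are added
    -- together; hence only an inequality for the length.
    grow-step : ∀ {s S ts v} → Grown (s ∷ S) ts → v ∉ s ∷ S →
      ∃[ s′ ] ∃[ S′ ] ∃[ ts′ ] (Grown (s′ ∷ S′) ts′ × suc (length (s ∷ S)) ≤ length (s′ ∷ S′))
    grow-step {s} {S} G v∉
      with Fin.any? (λ w → ¬? (mem? Fin._≟_ w (s ∷ S)) ×-dec (hasOut? (s ∷ S) w ×-dec hasIn? (s ∷ S) w))
    ... | yes (w , w∉ , out , inn)
      with x , x∈ , wx ← find out | y , y∈ , yw ← find inn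
      with t , G′ ← grow-mixed G w∉ x∈ wx y∈ yw = w , s ∷ S , t ∷ _ , G′ , ℕ.≤-refl
    ... | no ¬mixed
      with b , a , b∉ , a∉ , ¬b-out , a-out , ba ← dominated-dominating (s ∷ S) (here refl) v∉
        (λ w w∉ mixed → ¬mixed (w , w∉ , mixed))
      = let ts′ , G′ = grow-pair G a∉ b∉ (→b b∉ ¬b-out) ba (a→ a∉ a-out) in b , a ∷ s ∷ S , ts′ , G′ , ℕ.n≤1+n _
      where
      →b : ∀ {b x} → b ∉ s ∷ S → ¬ HasOut (s ∷ S) b → x ∈ s ∷ S → Arc A x b
      →b b∉ ¬out x∈ = arc-flip (λ { refl → b∉ x∈ }) (¬out ∘ lose x∈)
      a→ : ∀ {a x} → a ∉ s ∷ S → HasOut (s ∷ S) a → x ∈ s ∷ S → Arc A a x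
      a→ {a} a∉ out x∈ = arc-flip (λ { refl → a∉ x∈ }) (λ xa → ¬mixed (a , a∉ , out , lose x∈ xa))

    -- The fuel bounds the number of missing vertices. When it is used up, an outside vertex would
    -- make a duplicate-free list longer than `m`.
    grow : ∀ fuel {s S ts} → Grown (s ∷ S) ts → m ≤ fuel + length (s ∷ S) → m ≤ 2 + C₃ A
    grow fuel {s} {S} {ts} G enough with Fin.any? (λ v → ¬? (mem? Fin._≟_ v (s ∷ S)))
    grow fuel {s} {S} {ts} G enough | no full = ℕ.≤-trans covered (ℕ.≤-trans (Grown.bound G) (s≤s (s≤s counted)))
      where
      covered : m ≤ length (s ∷ S)
      covered = subst (_≤ length (s ∷ S)) (length-tabulate id) (unique-⊆⇒length-≤ (Unique.allFin⁺ m)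
        λ {x} _ → decidable-stable (mem? Fin._≟_ x (s ∷ S)) λ x∉ → full (x , x∉))
      counted : length ts ≤ C₃ A
      counted = unique-⊆⇒length-≤ (Grown.ts-unique G) (λ t∈ → ∈-threeCycles⁺ A (Grown.cycles G t∈))
    grow zero {s} {S} G enough | yes (v , v∉) =
      contradiction (ℕ.≤-trans (unique⇒length-≤ (fresh v∉ ∷ Grown.S-unique G)) enough) ℕ.1+n≰n
    grow (suc fuel) G enough | yes (v , v∉) with _ , _ , _ , G′ , longer ← grow-step G v∉ =
      grow fuel G′ (ℕ.≤-trans enough (ℕ.≤-trans (ℕ.≤-reflexive (sym (ℕ.+-suc fuel _))) (ℕ.+-monoʳ-≤ fuel longer)))

strong⇒order≤2+C₃ : {A : Matrix m} → IsTournament A → IsStrong A → m ≤ 2 + C₃ A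
strong⇒order≤2+C₃ {zero}  isT str = z≤n
strong⇒order≤2+C₃ {suc m} isT str = grow isT str (suc m) {zero} {[]} {[]} (record
  { S-unique  = [] ∷ []
  ; strong    = λ { X? (here refl) (here refl) Xx ¬Xx → contradiction Xx ¬Xx }
  ; ts-unique = []
  ; cycles    = λ ()
  ; within    = λ ()
  ; bound     = s≤s z≤n
  }) (ℕ.m≤m+n (suc m) 1)

-- The finitely checkable trace of strong connectivity: `IsStrong` ranges over all decidable sets,
-- so the enumeration tests this condition instead.
NoSourceOrSink : Matrix m → Set
NoSourceOrSink A = (∀ v → ∃[ w ] Arc A v w) × (∀ v → ∃[ w ] Arc A w v)

strong⇒noSourceOrSink : {A : Matrix m} → 2 ≤ m → IsStrong A → NoSourceOrSink A
strong⇒noSourceOrSink {A = A} (s≤s (s≤s _)) strong = out , inn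
  where
  out : ∀ v → ∃[ w ] Arc A v w
  out v with u , w , refl , _ , a ← strong (Fin._≟ v) {v} {punchIn v zero} refl (Fin.punchInᵢ≢i v zero) = w , a
  inn : ∀ v → ∃[ w ] Arc A w v
  inn v with u , w , _ , ¬¬w≡v , a ← strong
      (λ x → ¬? (x Fin.≟ v)) {punchIn v zero} {v} (Fin.punchInᵢ≢i v zero) (λ v≢v → v≢v refl)
    = u , subst (Arc A u) (decidable-stable (w Fin.≟ v) ¬¬w≡v) a

-- Strong components and permutations along arcs

module _ {M : Matrix n} (P : Partition M k) where
  open Partition P

  -- A walk between two vertices of a part stays in it, because each intermediate vertex can go on
  -- to the end and from there back to the start. Along the walk some arc leaves `X`.
  induced-strong : ∀ i → IsStrong (induced M (part i))
  induced-strong i {X} X? {x} {y} Xx ¬Xy =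
    cross x refl (proj₁ (linked (element-∈ S x) (element-∈ S y))) Xx
    where
    S = part i
    cross : ∀ {u} a → element S a ≡ u → Walk M u (element S y) → X a →
      ∃₂ λ u v → X u × ¬ X v × Arc (induced M S) u v
    cross a eq ε Xa = contradiction (subst X (element-injective S eq) Xa) ¬Xy
    cross a refl (arc ◅ walk) Xa
      with c , refl ← position (closed (element-∈ S a) (arc ◅ ε , walk ◅◅ proj₁ (linked (element-∈ S y) (element-∈ S a))))
      with X? c
    ... | yes Xc = cross c refl walk Xc
    ... | no ¬Xc = a , c , Xa , ¬Xc , arc

  cover-invariant : ∀ {σ : Fin n → Fin n} → Injective _≡_ _≡_ σ → (∀ v → Arc M v (σ v)) →
    ∀ {i v} → v ∈ˢ part i → σ v ∈ˢ part i
  cover-invariant {σ} σ-inj arcs {v = v} v∈ = closed v∈ (arcs v ◅ ε , walk-back σ σ-inj arcs v)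

  -- `v`, `σ v` and `σ (σ v)` stay in the part and are distinct, since a tournament has neither
  -- loops nor 2-cycles.
  cover⇒size≥3 : IsTournament M → ∀ {σ : Fin n → Fin n} → Injective _≡_ _≡_ σ → (∀ v → Arc M v (σ v)) →
    ∀ i → 3 ≤ ∣ part i ∣
  cover⇒size≥3 isT {σ} σ-inj arcs i with u , iff ← isStrong i
    with v∈ ← Equivalence.from (iff u) (ε , ε)
    with a , ea ← position v∈
       | b , eb ← position (cover-invariant σ-inj arcs v∈)
       | c , ec ← position (cover-invariant σ-inj arcs (cover-invariant σ-inj arcs v∈))
    = unique⇒length-≤ {xs = a ∷ b ∷ c ∷ []}
      ((apart ea eb (arc⇒≢ (arcs _)) ∷ apart ea ec v≢σσv ∷ []) ∷ (apart eb ec (arc⇒≢ (arcs _)) ∷ []) ∷ [] ∷ [])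
    where
    open Tournament isT
    apart : ∀ {a b x y} → element (part i) a ≡ x → element (part i) b ≡ y → x ≢ y → a ≢ b
    apart refl refl x≢y refl = x≢y refl
    v≢σσv : ∀ {v} → v ≢ σ (σ v)
    v≢σσv {v} eq = arc-asym (arcs v) (subst (Arc M (σ v)) (sym eq) (arcs (σ v)))

-- Upset tournaments have few 3-cycles

member-≥-first : ∀ {i j k x : Fin n} → i Fin.< j → j Fin.< k → Member x (i , j , k) → i Fin.≤ x
member-≥-first i<j j<k (inj₁ refl)        = Fin.≤-refl
member-≥-first i<j j<k (inj₂ (inj₁ refl)) = ℕ.<⇒≤ i<j
member-≥-first i<j j<k (inj₂ (inj₂ refl)) = ℕ.<⇒≤ (ℕ.<-trans i<j j<k)

member-≤-last : ∀ {i j k x : Fin n} → i Fin.< j → j Fin.< k → Member x (i , j , k) → x Fin.≤ k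
member-≤-last i<j j<k (inj₁ refl)        = ℕ.<⇒≤ (ℕ.<-trans i<j j<k)
member-≤-last i<j j<k (inj₂ (inj₁ refl)) = ℕ.<⇒≤ j<k
member-≤-last i<j j<k (inj₂ (inj₂ refl)) = Fin.≤-refl

-- The ends are recovered as the least and greatest members, and the middle is what remains.
increasing-triple-ext : ∀ {i j k i′ j′ k′ : Fin n} → i Fin.< j → j Fin.< k → i′ Fin.< j′ → j′ Fin.< k′ →
  (∀ {x} → Member x (i , j , k) → Member x (i′ , j′ , k′)) →
  (∀ {x} → Member x (i′ , j′ , k′) → Member x (i , j , k)) →
  (i , j , k) ≡ (i′ , j′ , k′)
increasing-triple-ext i<j j<k i<j′ j<k′ to from
  with refl ← Fin.≤-antisym (member-≥-first i<j j<k (from (inj₁ refl))) (member-≥-first i<j′ j<k′ (to (inj₁ refl)))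
     | refl ← Fin.≤-antisym (member-≤-last i<j′ j<k′ (to (inj₂ (inj₂ refl)))) (member-≤-last i<j j<k (from (inj₂ (inj₂ refl))))
  with to (inj₂ (inj₁ refl))
... | inj₁ refl        = contradiction i<j (ℕ.<-irrefl refl)
... | inj₂ (inj₁ refl) = refl
... | inj₂ (inj₂ refl) = contradiction j<k (ℕ.<-irrefl refl)

chain-mono : {A : Set} {_≺_ : A → A → Set} → (∀ {x y z} → x ≺ y → y ≺ z → x ≺ z) →
  ∀ {l} (f : Fin (suc l) → A) → (∀ i → f (inject₁ i) ≺ f (suc i)) → ∀ {i j} → i Fin.< j → f i ≺ f j
chain-mono tr {suc l} f step {zero}  {suc zero}    _         = step zero
chain-mono {_≺_ = _≺_} tr {suc l} f step {zero}  {suc (suc j)} _         =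
  tr (step zero) (chain-mono {_≺_ = _≺_} tr (f ∘ suc) (step ∘ suc) {zero} {suc j} z<s)
chain-mono {_≺_ = _≺_} tr {suc l} f step {suc i} {suc j}       (s<s i<j) =
  chain-mono {_≺_ = _≺_} tr (f ∘ suc) (step ∘ suc) i<j

outNeighbours : Matrix m → Fin m → List (Fin m)
outNeighbours {m} T u = filter (arc? T u) (allFin m)

outNeighbours-unique : (T : Matrix m) (u : Fin m) → Unique (outNeighbours T u)
outNeighbours-unique {m} T u = Unique.filter⁺ (arc? T u) (Unique.allFin⁺ m)

∈-outNeighbours⁻ : (T : Matrix m) {u v : Fin m} → v ∈ outNeighbours T u → Arc T u v
∈-outNeighbours⁻ {m} T {u} v∈ = proj₂ (∈-filter⁻ (arc? T u) {xs = allFin m} v∈)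

module _ {T : Matrix m} (isT : IsTournament T) where
  open Tournament isT

  -- Both an in-neighbour of `s` and `s` itself lie outside the out-neighbours, which together would
  -- make more than `m` vertices.
  full-outdegree⇒no-in : ∀ {s} → outdegree T s ≡ m ∸ 1 → ∀ {v} → ¬ Arc T v s
  full-outdegree⇒no-in {s} full {v} vs = ℕ.1+n≰n (ℕ.≤-trans (s≤s (ℕ.m≤n+m∸n m 1))
    (subst (λ d → 2 + d ≤ m) full (unique⇒length-≤ ((arc⇒≢ vs ∷ v∉) ∷ s∉ ∷ outNeighbours-unique T s))))
    where
    v∉ : All (v ≢_) (outNeighbours T s)
    v∉ = All.tabulate λ { x∈ refl → arc-asym vs (∈-outNeighbours⁻ T x∈) }
    s∉ : All (s ≢_) (outNeighbours T s)
    s∉ = All.tabulate λ { x∈ refl → arc⇒≢ (∈-outNeighbours⁻ T x∈) refl }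

zero-outdegree⇒no-out : {T : Matrix m} {s : Fin m} → outdegree T s ≡ 0 → ∀ {v} → ¬ Arc T s v
zero-outdegree⇒no-out {T = T} {s} empty {v} sv =
  contradiction (subst (0 <_) empty (∈-length (∈-filter⁺ (arc? T s) (∈-allFin v) sv))) λ ()

module _ {A : Matrix m} (isT : IsTournament A) (up : IsUpset A) where
  open IsUpset up
  open IsTransitiveTournament T-transitive renaming (isTournament to T-isT)
  open Path path
  open IsReversal reversal
  private
    module T = Tournament T-isT

  _≺_ : Fin m → Fin m → Set
  _≺_ = Arc T

  uses? : ∀ u v → Dec (Uses u v)
  uses? u v = Fin.any? λ i → (vertex (inject₁ i) Fin.≟ u) ×-dec (vertex (suc i) Fin.≟ v)

  uses⇒≺ : ∀ {u v} → Uses u v → u ≺ v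
  uses⇒≺ (i , refl , refl) = arcs i

  -- Away from the path `A` agrees with `T`, so an arc against the order `_≺_` can only come from
  -- the reversal.
  backward⇒uses : ∀ {a b} → a ≺ b → Arc A b a → Uses a b
  backward⇒uses {a} {b} a≺b ba = decidable-stable (uses? a b) λ ¬ab →
    T.arc-asym a≺b (trans (sym (off-path b a λ { (inj₁ u) → T.arc-asym a≺b (uses⇒≺ u) ; (inj₂ u) → ¬ab u })) ba)

  vertex-mono : ∀ {i j} → i Fin.< j → vertex i ≺ vertex j
  vertex-mono = chain-mono {_≺_ = _≺_} transitive vertex arcs

  vertex-cancel : ∀ {i j} → vertex i ≺ vertex j → i Fin.< j
  vertex-cancel {i} {j} lt with Fin.<-cmp i j
  ... | tri< i<j _ _  = i<j
  ... | tri≈ _ refl _ = contradiction refl (T.arc⇒≢ lt)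
  ... | tri> _ _ j<i  = contradiction (vertex-mono j<i) (T.arc-asym lt)

  vertex-step : ∀ {i j} → vertex (inject₁ i) ≺ vertex (suc j) → toℕ i ≤ toℕ j
  vertex-step {i} {j} lt = s≤s⁻¹ (subst (_< suc (toℕ j)) (Fin.toℕ-inject₁ i) (vertex-cancel lt))

  off-vertex : ∀ {i j} → vertex (inject₁ i) ≺ vertex j → ¬ vertex j ≺ vertex (suc i)
  off-vertex {i} {j} lt gt = ℕ.<⇒≱ (subst (_< toℕ j) (Fin.toℕ-inject₁ i) (vertex-cancel lt)) (s≤s⁻¹ (vertex-cancel gt))

  -- The middle vertex x of a 3-cycle determines it: if x lies off the path, the other two vertices
  -- are the consecutive path vertices around x, and otherwise they are its neighbours on the path.
  middle-determines : ∀ {a x b a′ b′} → CyclicTriple _≺_ A (a , x , b) → CyclicTriple _≺_ A (a′ , x , b′) →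
    (a , x , b) ≡ (a′ , x , b′)
  middle-determines ((ax , xb) , inj₁ (_ , _ , ba)) ((ax′ , xb′) , inj₁ (_ , _ , ba′))
    with i , refl , refl ← backward⇒uses (transitive ax xb) ba
       | j , refl , refl ← backward⇒uses (transitive ax′ xb′) ba′
    with refl ← Fin.≤-antisym {i = i} {j} (vertex-step (transitive ax xb′)) (vertex-step (transitive ax′ xb)) = refl
  -- The two kinds of cycle exclude each other: one puts `x` strictly between consecutive path
  -- vertices, the other on the path.
  middle-determines ((ax , xb) , inj₁ (_ , _ , ba)) ((ax′ , xb′) , inj₂ (_ , _ , xa′))
    with i , refl , refl ← backward⇒uses (transitive ax xb) ba
       | j , refl , refl ← backward⇒uses ax′ xa′ = contradiction xb (off-vertex ax)
  middle-determines ((ax , xb) , inj₂ (_ , _ , xa)) ((ax′ , xb′) , inj₁ (_ , _ , ba′))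
    with i , refl , refl ← backward⇒uses (transitive ax′ xb′) ba′
       | j , refl , refl ← backward⇒uses ax xa = contradiction xb′ (off-vertex ax′)
  middle-determines ((ax , xb) , inj₂ (_ , bx , xa)) ((ax′ , xb′) , inj₂ (_ , bx′ , xa′))
    with i , refl , i≡x ← backward⇒uses ax xa | i′ , refl , i′≡x ← backward⇒uses ax′ xa′
       | j , j≡x , refl ← backward⇒uses xb bx | j′ , j′≡x , refl ← backward⇒uses xb′ bx′
    with refl ← Fin.suc-injective (distinct (trans i≡x (sym i′≡x)))
       | refl ← Fin.inject₁-injective (distinct (trans j≡x (sym j′≡x))) = refl

  -- The listing by labels does not show the middle with respect to `_≺_`, so the vertices are
  -- sorted again by the arcs of `T`.
  Arrangement : Triple m → Set
  Arrangement t = ∃[ s ] (CyclicTriple _≺_ A s × (∀ {x} → Member x s → Member x t) × (∀ {x} → Member x t → Member x s))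

  arrange : ∀ {t} → InducesThreeCycle A t → Arrangement t
  arrange {i , j , k} (_ , inj₁ (ij , jk , ki))
    with s , cyc , (i∈ , j∈ , k∈) , s⊆ ← sort-cycle isT {R = _≺_} T.arc-total ij jk ki
    = s , cyc , s⊆ , λ { (inj₁ refl) → i∈ ; (inj₂ (inj₁ refl)) → j∈ ; (inj₂ (inj₂ refl)) → k∈ }
  arrange {i , j , k} (_ , inj₂ (ik , kj , ji))
    with s , cyc , (i∈ , k∈ , j∈) , s⊆ ← sort-cycle isT {R = _≺_} T.arc-total ik kj ji
    = s , cyc , (λ x∈ → flip (s⊆ x∈)) , λ { (inj₁ refl) → i∈ ; (inj₂ (inj₁ refl)) → j∈ ; (inj₂ (inj₂ refl)) → k∈ }
    where
    flip : ∀ {x} → x ≡ i ⊎ x ≡ k ⊎ x ≡ j → Member x (i , j , k)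
    flip (inj₁ e)        = inj₁ e
    flip (inj₂ (inj₁ e)) = inj₂ (inj₂ e)
    flip (inj₂ (inj₂ e)) = inj₂ (inj₁ e)

  middle : ∀ {t} → Arrangement t → Fin m
  middle ((_ , x , _) , _) = x

  middle-injective : ∀ {t t′} → InducesThreeCycle A t → InducesThreeCycle A t′ →
    (s : Arrangement t) (s′ : Arrangement t′) → middle s ≡ middle s′ → t ≡ t′
  middle-injective ((i<j , j<k) , _) ((i<j′ , j<k′) , _)
    ((a , x , b) , cyc , s⊆t , t⊆s) ((a′ , _ , b′) , cyc′ , s⊆t′ , t⊆s′) refl
    with refl ← middle-determines cyc cyc′ =
    increasing-triple-ext i<j j<k i<j′ j<k′ (λ x∈ → s⊆t′ (t⊆s x∈)) (λ x∈ → s⊆t (t⊆s′ x∈))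

  upset⇒2+C₃≤order : 2 + C₃ A ≤ m
  upset⇒2+C₃≤order = ℕ.≤-trans (s≤s (s≤s (injection⇒length-≤ {ys = inner}
      (λ t∈ → middle (arr t∈)) (threeCycles-unique A)
      (λ t∈ → ∈-filter⁺ inner? (∈-allFin _) (middle-inner (arr t∈)))
      λ t∈ t∈′ → middle-injective (∈-threeCycles⁻ A t∈) (∈-threeCycles⁻ A t∈′) (arr t∈) (arr t∈′))))
    (unique⇒length-≤ ((source≢sink ∷ All.tabulate (λ { x∈ refl → proj₁ (is-inner x∈) refl }))
      ∷ All.tabulate (λ { x∈ refl → proj₂ (is-inner x∈) refl })
      ∷ Unique.filter⁺ inner? (Unique.allFin⁺ m)))
    where
    inner? : ∀ x → Dec (x ≢ source × x ≢ sink)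
    inner? x = ¬? (x Fin.≟ source) ×-dec ¬? (x Fin.≟ sink)
    inner : List (Fin m)
    inner = filter inner? (allFin m)
    is-inner : ∀ {x} → x ∈ inner → x ≢ source × x ≢ sink
    is-inner x∈ = proj₂ (∈-filter⁻ inner? {xs = allFin m} x∈)
    arr : ∀ {t} → t ∈ threeCycles A → Arrangement t
    arr t∈ = arrange (∈-threeCycles⁻ A t∈)
    middle-inner : ∀ {t} (s : Arrangement t) → middle s ≢ source × middle s ≢ sink
    middle-inner (_ , ((ax , xb) , _) , _) =
      (λ { refl → full-outdegree⇒no-in T-isT source-outdegree ax }) ,
      (λ { refl → zero-outdegree⇒no-out {T = T} {sink} sink-outdegree xb })
    source≢sink : source ≢ sink
    source≢sink eq with () ← ℕ.≤-trans (ℕ.∸-monoˡ-≤ 1 order≥3)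
      (ℕ.≤-reflexive (trans (sym source-outdegree) (trans (cong (outdegree T) eq) sink-outdegree)))

-- Tournaments of order 3, 4 and 5

UniqueTransversal : Matrix n → Set
UniqueTransversal A = ∃[ h ] (IsTransversal A h × (∀ {σ} → IsTransversal A σ → ∀ i → σ i ≡ h i))

record _≅_ (A K : Matrix m) : Set where
  field
    to      : Fin m → Fin m
    from    : Fin m → Fin m
    to-from : ∀ x → to (from x) ≡ x
    from-to : ∀ i → from (to i) ≡ i
    entries : ∀ i j → A (to i) (to j) ≡ K i j

  to-injective : Injective _≡_ _≡_ to
  to-injective {i} {j} eq = trans (sym (from-to i)) (trans (cong from eq) (from-to j))

  from-injective : Injective _≡_ _≡_ from
  from-injective {x} {y} eq = trans (sym (to-from x)) (trans (cong to eq) (to-from y))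

  entries′ : ∀ x y → A x y ≡ K (from x) (from y)
  entries′ x y = trans (sym (cong₂ A (to-from x) (to-from y))) (entries (from x) (from y))

module _ {A K : Matrix m} (iso : A ≅ K) where
  open _≅_ iso

  -- A transversal `σ` of `A` is conjugated into the transversal `from ∘ σ ∘ to` of `K`, where
  -- uniqueness applies.
  uniqueTransversal-transport : UniqueTransversal K → UniqueTransversal A
  uniqueTransversal-transport (h , (h-inj , h-nz) , unique) = to ∘ h ∘ from
    , ((λ eq → from-injective (h-inj (to-injective eq)))
      , λ x Ax≡0 → h-nz (from x) (trans (sym (entries (from x) (h (from x))))
          (subst (λ z → A z (to (h (from x))) ≡ 0ℤ) (sym (to-from x)) Ax≡0)))
    , λ {σ} (σ-inj , σ-nz) x → trans (sym (to-from (σ x))) (cong to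
        (trans (cong (from ∘ σ) (sym (to-from x)))
          (unique {from ∘ σ ∘ to} ((λ eq → to-injective (σ-inj (from-injective eq))) , λ i Ki≡0 →
              σ-nz (to i) (trans (entries′ (to i) (σ (to i))) (trans (cong (λ z → K z (from (σ (to i)))) (from-to i)) Ki≡0)))
            (from x))))

  outdegree-relabel : (T : Matrix m) (s : Fin m) → outdegree (λ x y → T (from x) (from y)) (to s) ≡ outdegree T s
  outdegree-relabel T s = ℕ.≤-antisym
    (injection⇒length-≤ (λ {x} _ → from x) (outNeighbours-unique T′ (to s))
      (λ {x} p → ∈-filter⁺ (arc? T s) (∈-allFin _) (subst (λ z → Arc T z (from x)) (from-to s) (∈-outNeighbours⁻ T′ p)))
      (λ _ _ → from-injective))
    (injection⇒length-≤ (λ {x} _ → to x) (outNeighbours-unique T s)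
      (λ {x} p → ∈-filter⁺ (arc? T′ (to s)) (∈-allFin _)
        (subst₂ (Arc T) (sym (from-to s)) (sym (from-to x)) (∈-outNeighbours⁻ T p)))
      (λ _ _ → to-injective))
    where
    T′ : Matrix m
    T′ x y = T (from x) (from y)

  upset-transport : IsUpset K → IsUpset A
  upset-transport up = record
    { order≥3          = order≥3
    ; T                = T′
    ; T-transitive     = record
      { isTournament = restrict-tournament from-injective (IsTransitiveTournament.isTournament T-transitive)
      ; transitive   = IsTransitiveTournament.transitive T-transitive }
    ; source           = to source
    ; sink             = to sink
    ; source-outdegree = trans (outdegree-relabel T source) source-outdegree
    ; sink-outdegree   = trans (outdegree-relabel T sink) sink-outdegree
    ; path             = path′
    ; reversal         = record
      { on-path  = λ x y uses → trans (entries′ x y) (on-path (from x) (from y) (pull⊎ uses))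
      ; off-path = λ x y ¬uses → trans (entries′ x y) (off-path (from x) (from y) (¬uses ∘ push⊎)) }
    }
    where
    open IsUpset up
    open IsReversal reversal
    open Path path
    T′ : Matrix m
    T′ x y = T (from x) (from y)
    path′ : Path T′ (to source) (to sink)
    path′ = record
      { len      = len
      ; vertex   = to ∘ vertex
      ; distinct = distinct ∘ to-injective
      ; start    = cong to start
      ; end      = cong to end
      ; arcs     = λ i → subst₂ (Arc T) (sym (from-to _)) (sym (from-to _)) (arcs i)
      }
    pull : ∀ {x y} → Path.Uses path′ x y → Uses (from x) (from y)
    pull (i , refl , refl) = i , sym (from-to _) , sym (from-to _)
    push : ∀ {x y} → Uses (from x) (from y) → Path.Uses path′ x y
    push {x} {y} (i , p , q) = i , trans (cong to p) (to-from x) , trans (cong to q) (to-from y)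
    pull⊎ : ∀ {x y} → Path.Uses path′ x y ⊎ Path.Uses path′ y x → Uses (from x) (from y) ⊎ Uses (from y) (from x)
    pull⊎ (inj₁ u) = inj₁ (pull u)
    pull⊎ (inj₂ u) = inj₂ (pull u)
    push⊎ : ∀ {x y} → Uses (from x) (from y) ⊎ Uses (from y) (from x) → Path.Uses path′ x y ⊎ Path.Uses path′ y x
    push⊎ (inj₁ u) = inj₁ (push u)
    push⊎ (inj₂ u) = inj₂ (push u)

-- Enumerating small tournaments and recognising models

isTournament? : (A : Matrix m) → Dec (IsTournament A)
isTournament? A = map′ (λ (z , s) → record { zero-one = z ; M+Mᵀ≡J-I = s })
  (λ t → IsTournament.zero-one t , IsTournament.M+Mᵀ≡J-I t)
  (Fin.all? (λ i → Fin.all? λ j → (A i j ℤ.≟ 0ℤ) ⊎-dec (A i j ℤ.≟ 1ℤ)) ×-dec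
   Fin.all? (λ i → Fin.all? λ j → _ ℤ.≟ _))

injective? : (f : Fin m → Fin n) → Dec (Injective _≡_ _≡_ f)
injective? f = map′ (λ p {i} {j} → p i j) (λ p i j → p)
  (Fin.all? λ i → Fin.all? λ j → (f i Fin.≟ f j) →-dec (i Fin.≟ j))

-- The entries of a tournament matrix above the diagonal, row by row.
Code : ℕ → Set
Code zero    = ⊤
Code (suc m) = Vec Bool m × Code m

bit : Bool → ℤ
bit b = if b then 1ℤ else 0ℤ

decode : Code m → Matrix m
decode (r , c) zero    zero    = 0ℤ
decode (r , c) zero    (suc j) = bit (lookup r j)
decode (r , c) (suc i) zero    = bit (not (lookup r i))
decode (r , c) (suc i) (suc j) = decode c i j

encode : {A : Matrix m} → IsTournament A → ∃[ c ] (∀ i j → A i j ≡ decode {m} c i j)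
encode {zero}          isT = tt , λ ()
encode {suc m} {A = A} isT with c , eq ← encode (restrict-tournament Fin.suc-injective isT) = (tabulate row , c) , entry
  where
  open Tournament isT
  row : Fin m → Bool
  row j = does (arc? A zero (suc j))
  forward : ∀ j → A zero (suc j) ≡ bit (row j)
  forward j with arc? A zero (suc j)
  ... | yes a = a
  ... | no ¬a = arc⇒reverse-zero (arc-flip (λ ()) ¬a)
  backward : ∀ j → A (suc j) zero ≡ bit (not (row j))
  backward j with arc? A zero (suc j)
  ... | yes a = arc⇒reverse-zero a
  ... | no ¬a = arc-flip (λ ()) ¬a
  entry : ∀ i j → A i j ≡ decode (tabulate row , c) i j
  entry zero    zero    = diagonal zero
  entry zero    (suc j) = trans (forward j) (cong bit (sym (lookup∘tabulate row j)))
  entry (suc i) zero    = trans (backward i) (cong (bit ∘ not) (sym (lookup∘tabulate row i)))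
  entry (suc i) (suc j) = eq i j

all-rows? : ∀ m {P : Vec Bool m → Set} → (∀ r → Dec (P r)) → Dec (∀ r → P r)
all-rows? zero    P? = map′ (λ { p [] → p }) (λ p → p []) (P? [])
all-rows? (suc m) P? =
  map′ (λ { (p , q) (false ∷ r) → p r ; (p , q) (true ∷ r) → q r })
       (λ p → (λ r → p (false ∷ r)) , (λ r → p (true ∷ r)))
       (all-rows? m (λ r → P? (false ∷ r)) ×-dec all-rows? m (λ r → P? (true ∷ r)))

all-codes? : ∀ m {P : Code m → Set} → (∀ c → Dec (P c)) → Dec (∀ c → P c)
all-codes? zero    P? = map′ (λ p c → p) (λ p → p tt) (P? tt)
all-codes? (suc m) P? =
  map′ (λ { p (r , c) → p c r }) (λ p c r → p (r , c))
       (all-codes? m λ c → all-rows? m λ r → P? (r , c))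

-- Backtracking search for an embedding of K into A; C holds the conditions
-- that the images chosen so far impose on the remaining ones.
Match : ∀ {k} → Matrix m → Matrix k → (Fin k → Fin m → Set) → Set
Match {k = zero}  A K C = ⊤
Match {k = suc k} A K C = ∃[ u ] (C zero u × Match A (λ i j → K (suc i) (suc j))
  λ j v → (A u v ≡ K zero (suc j) × A v u ≡ K (suc j) zero) × C (suc j) v)

match? : ∀ {k} (A : Matrix m) (K : Matrix k) {C} → (∀ j v → Dec (C j v)) → Dec (Match A K C)
match? {k = zero}  A K C? = yes tt
match? {k = suc k} A K C? = Fin.any? λ u → C? zero u ×-dec match? A _
  λ j v → ((A u v ℤ.≟ K zero (suc j)) ×-dec (A v u ℤ.≟ K (suc j) zero)) ×-dec C? (suc j) v

match-sound : ∀ {k} (A : Matrix m) (K : Matrix k) {C} → Match A K C →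
  Σ[ π ∈ (Fin k → Fin m) ] ((∀ j → C j (π j)) × (∀ {i j} → i ≢ j → A (π i) (π j) ≡ K i j))
match-sound {k = zero}  A K _ = (λ ()) , (λ ()) , λ { {()} }
match-sound {m} {k = suc k} A K {C} (u , Cu , rest)
  with π , Cπ , eq ← match-sound A _ rest = π′ , C′ , eq′
  where
  π′ : Fin (suc k) → Fin m
  π′ zero    = u
  π′ (suc j) = π j
  C′ : ∀ j → C j (π′ j)
  C′ zero    = Cu
  C′ (suc j) = proj₂ (Cπ j)
  eq′ : ∀ {i j} → i ≢ j → A (π′ i) (π′ j) ≡ K i j
  eq′ {zero}  {zero}  i≢j = contradiction refl i≢j
  eq′ {zero}  {suc j} _   = proj₁ (proj₁ (Cπ j))
  eq′ {suc i} {zero}  _   = proj₂ (proj₁ (Cπ i))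
  eq′ {suc i} {suc j} i≢j = eq (i≢j ∘ cong suc)

Matches : Matrix m → Matrix m → Set
Matches A K = Match A K λ _ _ → ⊤

matches? : (A K : Matrix m) → Dec (Matches A K)
matches? A K = match? A K λ _ _ → yes tt

-- The search compares only entries off the diagonal and does not ask for injectivity. For
-- tournaments the diagonals vanish, and two vertices with the same image would turn an arc of `K`
-- into a loop of `A`.
matches⇒≅ : {A B K : Matrix m} → IsTournament A → IsTournament K → (∀ i j → A i j ≡ B i j) → Matches B K → A ≅ K
matches⇒≅ {A = A} {B} {K} A-isT K-isT A≗B match with π , _ , eq ← match-sound B K match = record
  { to = π ; from = λ x → proj₁ (π-surjective π eq x) ; to-from = λ x → proj₂ (π-surjective π eq x)
  ; from-to = λ i → π-injective π eq (proj₂ (π-surjective π eq (π i)))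
  ; entries = entries π eq }
  where
  module A = Tournament A-isT
  module K = Tournament K-isT
  module _ (π : Fin _ → Fin _) (eq : ∀ {i j} → i ≢ j → B (π i) (π j) ≡ K i j) where
    entries : ∀ i j → A (π i) (π j) ≡ K i j
    entries i j with i Fin.≟ j
    ... | yes refl = trans (A.diagonal (π i)) (sym (K.diagonal i))
    ... | no i≢j   = trans (A≗B (π i) (π j)) (eq i≢j)
    π-injective : Injective _≡_ _≡_ π
    π-injective {i} {j} πi≡πj with i Fin.≟ j
    ... | yes i≡j = i≡j
    ... | no i≢j with K.arc-total i≢j
    ...   | inj₁ ij = contradiction πi≡πj (A.arc⇒≢ (trans (entries i j) ij))
    ...   | inj₂ ji = contradiction (sym πi≡πj) (A.arc⇒≢ (trans (entries j i) ji))
    π-surjective : ∀ x → ∃[ i ] π i ≡ x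
    π-surjective = injective⇒surjective π-injective

noSourceOrSink? : (A : Matrix m) → Dec (NoSourceOrSink A)
noSourceOrSink? A =
  Fin.all? (λ v → Fin.any? λ w → arc? A v w) ×-dec Fin.all? (λ v → Fin.any? λ w → arc? A w v)

-- h is forced row by row, starting from the last row.
triangular⇒unique : (K : Matrix m) (h : Fin m → Fin m) → Injective _≡_ _≡_ h → (∀ i → K i (h i) ≢ 0ℤ) →
  (∀ i v → K i v ≢ 0ℤ → v ≡ h i ⊎ ∃[ j ] (i Fin.< j × v ≡ h j)) → UniqueTransversal K
triangular⇒unique K h h-inj h-nz tri = h , (h-inj , h-nz) , λ {σ} (σ-inj , σ-nz) i → forced σ-inj σ-nz i (>-wellFounded i)
  where
  forced : ∀ {σ} → Injective _≡_ _≡_ σ → (∀ i → K i (σ i) ≢ 0ℤ) → ∀ i → Acc Fin._>_ i → σ i ≡ h i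
  forced {σ} σ-inj σ-nz i (acc rs) with tri i (σ i) (σ-nz i)
  ... | inj₁ eq = eq
  ... | inj₂ (j , i<j , eq) = contradiction (σ-inj (trans eq (sym (forced σ-inj σ-nz j (rs i<j))))) (Fin.<⇒≢ i<j)

-- K arises from T by reversing the path p, and h is its only transversal.
module Model {m l} (K T : Matrix m) (p : Vec (Fin m) (suc l)) (h : Vec (Fin m) m) where
  V : Fin (suc l) → Fin m
  V = lookup p
  H : Fin m → Fin m
  H = lookup h

  UsesV : Fin m → Fin m → Set
  UsesV u v = ∃[ i ] (V (inject₁ i) ≡ u × V (suc i) ≡ v)
  usesV? : ∀ u v → Dec (UsesV u v)
  usesV? u v = Fin.any? λ i → (V (inject₁ i) Fin.≟ u) ×-dec (V (suc i) Fin.≟ v)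

  -- All requirements form one decidable proposition, so each concrete model is verified by
  -- evaluation and supplied as `tt`.
  IsModel : Set
  IsModel = (3 ≤ m × outdegree T (V zero) ≡ m ∸ 1 × outdegree T (V (fromℕ l)) ≡ 0)
    × (IsTournament T × (∀ u v w → Arc T u v → Arc T v w → Arc T u w))
    × (Injective _≡_ _≡_ V × (∀ i → Arc T (V (inject₁ i)) (V (suc i))))
    × ((∀ u v → UsesV u v ⊎ UsesV v u → K u v ≡ T v u) × (∀ u v → ¬ (UsesV u v ⊎ UsesV v u) → K u v ≡ T u v))
    × (Injective _≡_ _≡_ H × (∀ i → K i (H i) ≢ 0ℤ) × (∀ i v → K i v ≢ 0ℤ → v ≡ H i ⊎ ∃[ j ] (i Fin.< j × v ≡ H j)))
    × IsTournament K

  isModel? : Dec IsModel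
  isModel? = ((3 ℕ.≤? m) ×-dec (_ ℕ.≟ _) ×-dec (_ ℕ.≟ _))
    ×-dec (isTournament? T
           ×-dec Fin.all? λ u → Fin.all? λ v → Fin.all? λ w → arc? T u v →-dec (arc? T v w →-dec arc? T u w))
    ×-dec (injective? V ×-dec Fin.all? λ i → arc? T _ _)
    ×-dec ((Fin.all? λ u → Fin.all? λ v → (usesV? u v ⊎-dec usesV? v u) →-dec (_ ℤ.≟ _))
           ×-dec (Fin.all? λ u → Fin.all? λ v → ¬? (usesV? u v ⊎-dec usesV? v u) →-dec (_ ℤ.≟ _)))
    ×-dec (injective? H ×-dec (Fin.all? λ i → ¬? (_ ℤ.≟ _))
           ×-dec (Fin.all? λ i → Fin.all? λ v → ¬? (_ ℤ.≟ _) →-dec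
             ((v Fin.≟ H i) ⊎-dec Fin.any? λ j → (i Fin.<? j) ×-dec (v Fin.≟ H j))))
    ×-dec isTournament? K

  module _ (model : True isModel?) where
    private
      facts = toWitness model

    upset : IsUpset K
    upset with (m≥3 , source-deg , sink-deg) , (T-isT , T-trans) , (V-inj , V-arcs) , (on , off) , _ ← facts = record
      { order≥3 = m≥3 ; T = T ; T-transitive = record { isTournament = T-isT ; transitive = T-trans _ _ _ }
      ; source = V zero ; sink = V (fromℕ l) ; source-outdegree = source-deg ; sink-outdegree = sink-deg
      ; path = record { len = l ; vertex = V ; distinct = V-inj ; start = refl ; end = refl ; arcs = V-arcs }
      ; reversal = record { on-path = on ; off-path = off } }

    uniqueTransversal : UniqueTransversal K
    uniqueTransversal with _ , _ , _ , _ , (H-inj , H-nz , tri) , _ ← facts = triangular⇒unique K H H-inj H-nz tri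

    matches⇒upset : {A B : Matrix m} → IsTournament A → (∀ i j → A i j ≡ B i j) → Matches B K →
      IsUpset A × UniqueTransversal A
    matches⇒upset A-isT A≗B match with _ , _ , _ , _ , _ , K-isT ← facts
      with iso ← matches⇒≅ A-isT K-isT A≗B match
      = upset-transport iso upset , uniqueTransversal-transport iso uniqueTransversal

C₃-cong : {A B : Matrix m} → (∀ i j → A i j ≡ B i j) → C₃ A ≡ C₃ B
C₃-cong {A = A} {B} A≗B = ℕ.≤-antisym
  (mono A B λ i j → sym (A≗B i j)) (mono B A A≗B)
  where
  cycle-cong : ∀ (A B : Matrix m) → (∀ i j → B i j ≡ A i j) → ∀ {t} → InducesThreeCycle A t → InducesThreeCycle B t
  cycle-cong A B eq (lt , inj₁ (x , y , z)) = lt , inj₁ (trans (eq _ _) x , trans (eq _ _) y , trans (eq _ _) z)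
  cycle-cong A B eq (lt , inj₂ (x , y , z)) = lt , inj₂ (trans (eq _ _) x , trans (eq _ _) y , trans (eq _ _) z)
  mono : ∀ (A B : Matrix m) → (∀ i j → B i j ≡ A i j) → C₃ A ≤ C₃ B
  mono A B eq = unique-⊆⇒length-≤ (threeCycles-unique A) λ t∈ → ∈-threeCycles⁺ B (cycle-cong A B eq (∈-threeCycles⁻ A t∈))

noSourceOrSink-cong : {A B : Matrix m} → (∀ i j → A i j ≡ B i j) → NoSourceOrSink A → NoSourceOrSink B
noSourceOrSink-cong A≗B (out , inn) =
  (λ v → let w , a = out v in w , trans (sym (A≗B v w)) a) , (λ v → let w , a = inn v in w , trans (sym (A≗B w v)) a)

-- K₃, K₄, K₅ have a single back arc, from the last vertex to the first. In K₅′ the order is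
-- 0 < 2 < 1 < 3 < 4 and the path is 0, 1, 4; the labels make the transversal triangular.
K₃ T₃ : Code 3
T₃ = (true ∷ true ∷ []) , (true ∷ []) , [] , tt
K₃ = (true ∷ false ∷ []) , (true ∷ []) , [] , tt

K₄ T₄ : Code 4
T₄ = (true ∷ true ∷ true ∷ []) , T₃
K₄ = (true ∷ true ∷ false ∷ []) , T₃

K₅ T₅ : Code 5
T₅ = (true ∷ true ∷ true ∷ true ∷ []) , T₄
K₅ = (true ∷ true ∷ true ∷ false ∷ []) , T₄

K₅′ T₅′ : Code 5
T₅′ = (true ∷ true ∷ true ∷ true ∷ []) , (false ∷ true ∷ true ∷ []) , T₃
K₅′ = (false ∷ true ∷ true ∷ true ∷ []) , (false ∷ true ∷ false ∷ []) , T₃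

module M₃ = Model (decode K₃) (decode T₃) (0F ∷ 2F ∷ []) (1F ∷ 2F ∷ 0F ∷ [])
module M₄ = Model (decode K₄) (decode T₄) (0F ∷ 3F ∷ []) (1F ∷ 2F ∷ 3F ∷ 0F ∷ [])
module M₅ = Model (decode K₅) (decode T₅) (0F ∷ 4F ∷ []) (1F ∷ 2F ∷ 3F ∷ 4F ∷ 0F ∷ [])
module M₅′ = Model (decode K₅′) (decode T₅′) (0F ∷ 1F ∷ 4F ∷ []) (2F ∷ 0F ∷ 3F ∷ 4F ∷ 1F ∷ [])

-- Evaluation over all 8 codes of order 3; the next two orders have 64 and 1024 codes.
classify₃ : ∀ c → NoSourceOrSink (decode c) → C₃ (decode c) ≡ 1 → Matches (decode c) (decode K₃)
classify₃ = from-yes (all-codes? 3 λ c → noSourceOrSink? (decode c) →-dec ((C₃ (decode c) ℕ.≟ 1) →-dec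
  matches? (decode c) (decode K₃)))

classify₄ : ∀ c → NoSourceOrSink (decode c) → C₃ (decode c) ≡ 2 → Matches (decode c) (decode K₄)
classify₄ = from-yes (all-codes? 4 λ c → noSourceOrSink? (decode c) →-dec ((C₃ (decode c) ℕ.≟ 2) →-dec
  matches? (decode c) (decode K₄)))

-- Order 5 has two models, according to whether the reversed path has one arc or two.
classify₅ : ∀ c → NoSourceOrSink (decode c) → C₃ (decode c) ≡ 3 →
  Matches (decode c) (decode K₅) ⊎ Matches (decode c) (decode K₅′)
classify₅ = from-yes (all-codes? 5 λ c → noSourceOrSink? (decode c) →-dec ((C₃ (decode c) ℕ.≟ 3) →-dec
  (matches? (decode c) (decode K₅) ⊎-dec matches? (decode c) (decode K₅′))))

-- Stated for variable k: at a numeral, type checking would unfold C₃ on an unknown matrix.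
by-enumeration : ∀ k (Q : Matrix (2 + k) → Set) →
  (∀ c → NoSourceOrSink (decode c) → C₃ (decode c) ≡ k → Q (decode c)) →
  {A : Matrix (2 + k)} → IsTournament A → NoSourceOrSink A → 2 + C₃ A ≡ 2 + k →
  {R : Set} → (∀ {B} → (∀ i j → A i j ≡ B i j) → Q B → R) → R
by-enumeration k Q classify isT nss C₃≡ conclude with c , A≗B ← encode isT = conclude A≗B
  (classify c (noSourceOrSink-cong A≗B nss) (trans (sym (C₃-cong A≗B)) (ℕ.+-cancelˡ-≡ 2 _ _ C₃≡)))

small⇒upset : {A : Matrix m} → 3 ≤ m → m ≤ 5 → IsTournament A → NoSourceOrSink A → 2 + C₃ A ≡ m →
  IsUpset A × UniqueTransversal A
small⇒upset {3} _ _ isT nss C₃≡ =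
  by-enumeration 1 (λ B → Matches B (decode K₃)) classify₃ isT nss C₃≡ (M₃.matches⇒upset tt isT)
small⇒upset {4} _ _ isT nss C₃≡ =
  by-enumeration 2 (λ B → Matches B (decode K₄)) classify₄ isT nss C₃≡ (M₄.matches⇒upset tt isT)
small⇒upset {5} _ _ isT nss C₃≡ =
  by-enumeration 3 (λ B → Matches B (decode K₅) ⊎ Matches B (decode K₅′)) classify₅ isT nss C₃≡
    λ A≗B → [ M₅.matches⇒upset tt isT A≗B , M₅′.matches⇒upset tt isT A≗B ]′
small⇒upset {0} () _ _ _ _
small⇒upset {1} (s≤s ()) _ _ _ _
small⇒upset {2} (s≤s (s≤s ())) _ _ _ _
small⇒upset {suc (suc (suc (suc (suc (suc m)))))} _ (s≤s (s≤s (s≤s (s≤s (s≤s ()))))) _ _ _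

-- Assembling the components

sum-const-+ : ∀ c (f : Fin k → ℕ) → sum (λ i → c + f i) ≡ k * c + sum f
sum-const-+ {zero}  c f = refl
sum-const-+ {suc k} c f = begin
  c + f zero + sum (λ i → c + f (suc i))   ≡⟨ cong (c + f zero +_) (sum-const-+ c (f ∘ suc)) ⟩
  c + f zero + (k * c + sum (f ∘ suc))     ≡⟨ ℕ.+-assoc c (f zero) _ ⟩
  c + (f zero + (k * c + sum (f ∘ suc)))   ≡⟨ cong (c +_) (ℕ.+-assoc (f zero) (k * c) _) ⟨
  c + (f zero + k * c + sum (f ∘ suc))     ≡⟨ cong (λ x → c + (x + sum (f ∘ suc))) (ℕ.+-comm (f zero) (k * c)) ⟩
  c + (k * c + f zero + sum (f ∘ suc))     ≡⟨ cong (c +_) (ℕ.+-assoc (k * c) (f zero) _) ⟩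
  c + (k * c + (f zero + sum (f ∘ suc)))   ≡⟨ ℕ.+-assoc c (k * c) _ ⟨
  c + k * c + (f zero + sum (f ∘ suc))     ∎
  where open ≡-Reasoning

sum-mono : {f g : Fin k → ℕ} → (∀ i → f i ≤ g i) → sum f ≤ sum g
sum-mono {zero}  f≤g = z≤n
sum-mono {suc k} f≤g = ℕ.+-mono-≤ (f≤g zero) (sum-mono (f≤g ∘ suc))

sum-const : ∀ k c → sum {k} (λ _ → c) ≡ k * c
sum-const zero    c = refl
sum-const (suc k) c = cong (c +_) (sum-const k c)

-- No single difference exceeds the total one, as the others are nonnegative. With `d = 2` this
-- bounds the part sizes by 5; with `d = 0` it turns equal sums into equal terms.
sum-slack : ∀ {d} {f g : Fin k → ℕ} → (∀ i → f i ≤ g i) → sum g ≤ d + sum f → ∀ i → g i ≤ d + f i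
sum-slack {suc k} {d} {f} {g} f≤g slack zero = ℕ.+-cancelʳ-≤ (sum (f ∘ suc)) _ _ (begin
  g zero + sum (f ∘ suc)       ≤⟨ ℕ.+-monoʳ-≤ (g zero) (sum-mono (f≤g ∘ suc)) ⟩
  g zero + sum (g ∘ suc)       ≤⟨ slack ⟩
  d + (f zero + sum (f ∘ suc)) ≡⟨ ℕ.+-assoc d (f zero) _ ⟨
  d + f zero + sum (f ∘ suc)   ∎)
  where open ℕ.≤-Reasoning
sum-slack {suc k} {d} {f} {g} f≤g slack (suc i) = sum-slack (f≤g ∘ suc) (ℕ.+-cancelˡ-≤ (f zero) _ _ (begin
  f zero + sum (g ∘ suc)       ≤⟨ ℕ.+-monoˡ-≤ _ (f≤g zero) ⟩
  g zero + sum (g ∘ suc)       ≤⟨ slack ⟩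
  d + (f zero + sum (f ∘ suc)) ≡⟨ ℕ.+-assoc d (f zero) _ ⟨
  d + f zero + sum (f ∘ suc)   ≡⟨ cong (_+ sum (f ∘ suc)) (ℕ.+-comm d (f zero)) ⟩
  f zero + d + sum (f ∘ suc)   ≡⟨ ℕ.+-assoc (f zero) d _ ⟩
  f zero + (d + sum (f ∘ suc)) ∎)) i
  where open ℕ.≤-Reasoning

n≤2+[n/3]*3 : ∀ n → n ≤ 2 + n / 3 * 3
n≤2+[n/3]*3 n = ℕ.≤-trans (ℕ.≤-reflexive (m≡m%n+[m/n]*n n 3)) (ℕ.+-monoˡ-≤ (n / 3 * 3) (s≤s⁻¹ (m%n<n n 3)))

2*[n/3]≤n : ∀ n → 2 * (n / 3) ≤ n
2*[n/3]≤n n = ℕ.≤-trans (ℕ.*-monoˡ-≤ (n / 3) {2} {3} (s≤s (s≤s z≤n)))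
  (ℕ.≤-trans (ℕ.≤-reflexive (ℕ.*-comm 3 (n / 3))) (m/n*n≤m n 3))

module Assembly {M : Matrix n} (isT : IsTournament M) (P : Partition M k) where
  open Partition P
  open Tournament isT

  size : Fin k → ℕ
  size i = ∣ part i ∣

  sub : ∀ i → Matrix (size i)
  sub i = induced M (part i)

  sub-isT : ∀ i → IsTournament (sub i)
  sub-isT i = restrict-tournament (element-injective (part i)) isT

  size≤2+C₃ : ∀ i → size i ≤ 2 + C₃ (sub i)
  size≤2+C₃ i = strong⇒order≤2+C₃ (sub-isT i) (induced-strong P i)

  sum-2+C₃ : sum (λ i → 2 + C₃ (sub i)) ≡ 2 * k + C₃ M
  sum-2+C₃ = trans (sum-const-+ 2 (λ i → C₃ (sub i))) (trans (cong (k * 2 +_) (sum-C₃ P)) (cong (_+ C₃ M) (ℕ.*-comm k 2)))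

  n≤2k+C₃ : n ≤ 2 * k + C₃ M
  n≤2k+C₃ = ℕ.≤-trans (ℕ.≤-reflexive (sym (sum-sizes P))) (ℕ.≤-trans (sum-mono size≤2+C₃) (ℕ.≤-reflexive sum-2+C₃))

  transversal⇒arcs : ∀ {σ} → IsTransversal M σ → ∀ v → Arc M v (σ v)
  transversal⇒arcs (_ , nz) v = nonzero⇒arc (nz v)

  nonsingular⇒size≥3 : ¬ Singular M → ∀ i → 3 ≤ size i
  nonsingular⇒size≥3 ns i = let σ , tr = det≢0⇒transversal M ns in
    cover⇒size≥3 P isT (proj₁ tr) (transversal⇒arcs tr) i

  size≥3⇒k≤n/3 : (∀ i → 3 ≤ size i) → k ≤ n / 3
  size≥3⇒k≤n/3 size≥3 = subst (_≤ n / 3) (m*n/n≡m k 3) (/-monoˡ-≤ 3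
    (ℕ.≤-trans (ℕ.≤-reflexive (sym (sum-const k 3))) (ℕ.≤-trans (sum-mono size≥3) (ℕ.≤-reflexive (sum-sizes P)))))

  -- The sizes sum to `n`, which exceeds `3k` by at most 2, so no part exceeds 3 by more than 2.
  size≤5 : k ≡ n / 3 → (∀ i → 3 ≤ size i) → ∀ i → size i ≤ 5
  size≤5 refl size≥3 = sum-slack size≥3 (ℕ.≤-trans (ℕ.≤-reflexive (sum-sizes P))
    (ℕ.≤-trans (n≤2+[n/3]*3 n) (ℕ.≤-reflexive (cong (2 +_) (sym (sum-const k 3))))))

  small-part : k ≡ n / 3 → (∀ i → 3 ≤ size i) → (∀ i → 2 + C₃ (sub i) ≤ size i) →
    ∀ i → IsUpset (sub i) × UniqueTransversal (sub i)
  small-part k≡ size≥3 tight i = small⇒upset (size≥3 i) (size≤5 k≡ size≥3 i) (sub-isT i)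
    (strong⇒noSourceOrSink (ℕ.≤-trans (s≤s (s≤s z≤n)) (size≥3 i)) (induced-strong P i))
    (ℕ.≤-antisym (tight i) (size≤2+C₃ i))

  module _ (unique : ∀ i → UniqueTransversal (sub i)) where
    local : ∀ i → Fin (size i) → Fin (size i)
    local i = proj₁ (unique i)

    global : Fin n → Fin n
    global v = let i , v∈ = covers v ; a , _ = position v∈ in element (part i) (local i a)

    locate : ∀ v → ∃[ i ] ∃[ a ] v ≡ element (part i) a
    locate v = let i , v∈ = covers v ; a , eq = position v∈ in i , a , sym eq

    -- `global` goes through a chosen part and position of its argument; disjointness of the parts
    -- and injectivity of `element` identify the choice with `i` and `a`.
    global-element : ∀ i a → global (element (part i) a) ≡ element (part i) (local i a)
    global-element i a with covers (element (part i) a)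
    ... | j , v∈ with disjoint v∈ (element-∈ (part i) a)
    ...   | refl with position v∈
    ...     | b , eq = cong (element (part i) ∘ local i) (element-injective (part i) eq)

    global-transversal : IsTransversal M global
    global-transversal = inj , nz
      where
      inj : Injective _≡_ _≡_ global
      inj {v} {w} eq with i , a , refl ← locate v | j , b , refl ← locate w
        with eq′ ← trans (sym (global-element i a)) (trans eq (global-element j b))
        with refl ← disjoint {i = i} {j} (element-∈ (part i) (local i a))
          (subst (_∈ˢ part j) (sym eq′) (element-∈ (part j) (local j b)))
        = cong (element (part i)) (proj₁ (proj₁ (proj₂ (unique i))) (element-injective (part i) eq′))
      nz : ∀ v → M v (global v) ≢ 0ℤ
      nz v with i , a , refl ← locate v =
        subst (λ w → M (element (part i) a) w ≢ 0ℤ) (sym (global-element i a)) (proj₂ (proj₁ (proj₂ (unique i))) a)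

    -- A transversal preserves every part, so it restricts to a transversal of each, which must be
    -- the local one.
    global-unique : ∀ {σ} → IsTransversal M σ → ∀ v → σ v ≡ global v
    global-unique {σ} tr@(σ-inj , σ-nz) v with i , a , refl ← locate v =
      trans (sym (σᵢ-element a)) (trans
        (cong (element (part i)) (proj₂ (proj₂ (unique i)) {σᵢ} (σᵢ-inj , σᵢ-nz) a)) (sym (global-element i a)))
      where
      σ-position : ∀ a → ∃[ b ] element (part i) b ≡ σ (element (part i) a)
      σ-position a = position (cover-invariant P σ-inj (transversal⇒arcs tr) (element-∈ (part i) a))
      σᵢ : Fin (size i) → Fin (size i)
      σᵢ a = proj₁ (σ-position a)
      σᵢ-element : ∀ a → element (part i) (σᵢ a) ≡ σ (element (part i) a)
      σᵢ-element a = proj₂ (σ-position a)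
      σᵢ-inj : Injective _≡_ _≡_ σᵢ
      σᵢ-inj {a} {b} eq = element-injective (part i) (σ-inj
        (trans (sym (σᵢ-element a)) (trans (cong (element (part i)) eq) (σᵢ-element b))))
      σᵢ-nz : ∀ a → sub i a (σᵢ a) ≢ 0ℤ
      σᵢ-nz a = subst (λ w → M (element (part i) a) w ≢ 0ℤ) (sym (σᵢ-element a)) (σ-nz (element (part i) a))

    nonsingular : ¬ Singular M
    nonsingular = unique-transversal⇒det≢0 M global-transversal global-unique

theorem3p3 : (n : ℕ) → 3 ≤ n → (M : Matrix n) → IsTournament M →
    (¬ Singular M → C₃ M ≥ n ∸ 2 * (n / 3)) ×
    ((¬ Singular M × C₃ M ≡ n ∸ 2 * (n / 3)) ⇔
    ((∀ S → IsStrongComponent M S → IsUpset (induced M S)) ×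
    NumberOfStrongComponents M (n / 3)))
theorem3p3 n _ M isT = lower-bound , mk⇔ extremal⇒upsets upsets⇒extremal
  where
  components = numberOfStrongComponents M
  open Assembly isT (partition components)

  lower-bound : ¬ Singular M → C₃ M ≥ n ∸ 2 * (n / 3)
  lower-bound ns = ℕ.m≤n+o⇒m∸n≤o n (2 * (n / 3)) (ℕ.≤-trans n≤2k+C₃
    (ℕ.+-monoˡ-≤ (C₃ M) (ℕ.*-monoʳ-≤ 2 (size≥3⇒k≤n/3 (nonsingular⇒size≥3 ns)))))

  extremal⇒upsets : ¬ Singular M × C₃ M ≡ n ∸ 2 * (n / 3) →
    (∀ S → IsStrongComponent M S → IsUpset (induced M S)) × NumberOfStrongComponents M (n / 3)
  extremal⇒upsets (ns , C₃≡) = upsets , subst (NumberOfStrongComponents M) k≡n/3 components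
    where
    size≥3 = nonsingular⇒size≥3 ns

    2[n/3]+C₃≡n : 2 * (n / 3) + C₃ M ≡ n
    2[n/3]+C₃≡n = trans (cong (2 * (n / 3) +_) C₃≡) (ℕ.m+[n∸m]≡n (2*[n/3]≤n n))

    -- Equality turns `n ≤ 2k + C₃ M` into `2 * (n / 3) ≤ 2k`, opposite to the bound from the part
    -- sizes.
    k≡n/3 = ℕ.≤-antisym (size≥3⇒k≤n/3 size≥3)
      (ℕ.*-cancelˡ-≤ 2 (ℕ.+-cancelʳ-≤ (C₃ M) _ _ (ℕ.≤-trans (ℕ.≤-reflexive 2[n/3]+C₃≡n) n≤2k+C₃)))

    -- The bounds `size i ≤ 2 + C₃ (sub i)` add up to an equality, so each of them is one.
    tight : ∀ i → 2 + C₃ (sub i) ≤ size i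
    tight = sum-slack {d = 0} size≤2+C₃ (ℕ.≤-reflexive (trans sum-2+C₃
      (trans (cong (λ k → 2 * k + C₃ M) k≡n/3) (trans 2[n/3]+C₃≡n (sym (sum-sizes (partition components)))))))

    upsets : ∀ S → IsStrongComponent M S → IsUpset (induced M S)
    upsets S strong with i , refl ← Equivalence.to (proj₂ (proj₂ components) S) strong =
      proj₁ (small-part k≡n/3 size≥3 tight i)

  upsets⇒extremal : (∀ S → IsStrongComponent M S → IsUpset (induced M S)) × NumberOfStrongComponents M (n / 3) →
    ¬ Singular M × C₃ M ≡ n ∸ 2 * (n / 3)
  upsets⇒extremal (upsets , number) =
    -- With `n / 3` parts of size at least 3, all orders are 3, 4 or 5, and the classification
    -- supplies the unique transversals.
    Q.nonsingular (λ i → proj₂ (Q.small-part refl size≥3 tight i))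
    , trans (sym (ℕ.m+n∸m≡n (2 * (n / 3)) (C₃ M))) (cong (_∸ 2 * (n / 3)) sum≡)
    where
    parts = partition number
    module Q = Assembly isT parts
    open Partition parts using (part; isStrong)

    part-upset : ∀ i → IsUpset (induced M (part i))
    part-upset i = upsets (part i) (isStrong i)

    size≥3 : ∀ i → 3 ≤ Q.size i
    size≥3 i = IsUpset.order≥3 (part-upset i)

    tight : ∀ i → 2 + C₃ (Q.sub i) ≤ Q.size i
    tight i = upset⇒2+C₃≤order (Q.sub-isT i) (part-upset i)

    -- The opposite bounds for upset and for strong tournaments are summed over the parts.
    sum≡ : 2 * (n / 3) + C₃ M ≡ n
    sum≡ = ℕ.≤-antisym
      (ℕ.≤-trans (ℕ.≤-reflexive (sym Q.sum-2+C₃)) (ℕ.≤-trans (sum-mono tight) (ℕ.≤-reflexive (sum-sizes parts))))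
      Q.n≤2k+C₃
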